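{- Let $R$ be a relation over the universe of $\mathcal{P}^W(\Delta_1)$. If $R$ is definable in some $\Delta_2$-presentation $f$ of $\mathcal{P}^W(\Delta_1)$, then $R$ is definable in every $\Delta_2$-presentation of $\mathcal{P}^W(\Delta_1)$.
   Context: $\Delta_1$ is the unlabeled tree with domain $0^*$, identified with $(\mathbb{N},\mathit{succ})$; $\Delta_2$ is the unlabeled tree with domain $\{0,1\}^*$ (the infinite binary tree) with binary relations $S_i(u,v)\iff v=ui$ ($i=0,1$). WMSO is MSO with set variables ranging over finite sets. The weak powerset $\mathcal{P}^W(\mathcal{T})$ of a structure $\mathcal{T}$ of signature $\Sigma$ is the structure of signature $\Sigma\cup\{\preceq\}$ whose universe is the set of finite subsets of the universe of $\mathcal{T}$, in which each $R\in\Sigma$ holds of a tuple of singletons $(\{u_1\},\dots,\{u_r\})$ iff $R(u_1,\dots,u_r)$ holds in $\mathcal{T}$ (and of no other tuples), and $\preceq$ is inclusion. Given a structure $\mathcal{T}$, a $\mathcal{T}$-presentation of a structure $\mathcal{S}$ with universe $\mathcal{U}$ is an injection $f$ from $\mathcal{U}$ into the finite subsets of the universe of $\mathcal{T}$ such that $f(\mathcal{U})$ is WMSO-definable in $\mathcal{T}$ and for each relation $R$ of $\mathcal{S}$ of arity $r$ there is a WMSO formula $\phi_R(X_1,\dots,X_r)$ over $\mathcal{T}$ with $(u_1,\dots,u_r)\in R$ iff $\mathcal{T}\models\phi_R(f(u_1),\dots,f(u_r))$. A relation $R'$ on $\mathcal{U}$ is definable in $f$ if $f$ is also a $\mathcal{T}$-presentation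 of $\mathcal{S}$ expanded by $R'$. -}

module Defs where

open import Data.Nat using (ℕ; suc)
open import Data.Bool using (Bool; true; false)
open import Data.Fin using (Fin; zero; suc)
open import Data.List using (List; []; _∷_; _++_; [_])
open import Data.List.Membership.Propositional using (_∈_)
open import Data.List.Relation.Binary.Subset.Propositional using (_⊆_)
open import Data.Product using (Σ; ∃; _×_; _,_)
open import Data.Sum using (_⊎_)
open import Data.Empty using (⊥)
open import Function using (_⇔_; _∘_)
open import Relation.Binary.PropositionalEquality using (_≡_)

-- Finite sets are represented by lists, considered up to extensional
-- (set) equality.

FinSet : Set → Set
FinSet A = List A

_≈ˢ_ : {A : Set} → FinSet A → FinSet A → Set
X ≈ˢ Y = (X ⊆ Y) × (Y ⊆ X)

-- The infinite binary tree Δ₂: nodes are words over {0,1}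
-- (false = 0, true = 1); S_i(u,v) iff v = u i.

Word : Set
Word = List Bool

-- Δ₁ = (ℕ, succ) (the word 0^n is identified with n).

-- WMSO over Δ₂.  Form m n: formulas with m free first-order variables
-- and n free (weak) set variables, in de Bruijn style.

data Form (m n : ℕ) : Set where
  _∈′_  : Fin m → Fin n → Form m n
  _≐_   : Fin m → Fin m → Form m n
  S₀    : Fin m → Fin m → Form m n
  S₁    : Fin m → Fin m → Form m n
  ¬′_   : Form m n → Form m n
  _∧′_  : Form m n → Form m n → Form m n
  _∨′_  : Form m n → Form m n → Form m n
  ∃¹    : Form (suc m) n → Form m n
  ∀¹    : Form (suc m) n → Form m n
  ∃ˢ    : Form m (suc n) → Form m n
  ∀ˢ    : Form m (suc n) → Form m n

extend : {k : ℕ} {A : Set} → A → (Fin k → A) → Fin (suc k) → A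
extend a ρ zero    = a
extend a ρ (suc i) = ρ i

Sat : {m n : ℕ} → Form m n → (Fin m → Word) → (Fin n → FinSet Word) → Set
Sat (x ∈′ X) σ τ = σ x ∈ τ X
Sat (x ≐ y)  σ τ = σ x ≡ σ y
Sat (S₀ x y) σ τ = σ y ≡ σ x ++ [ false ]
Sat (S₁ x y) σ τ = σ y ≡ σ x ++ [ true ]
Sat (¬′ φ)   σ τ = Sat φ σ τ → ⊥
Sat (φ ∧′ ψ) σ τ = Sat φ σ τ × Sat ψ σ τ
Sat (φ ∨′ ψ) σ τ = Sat φ σ τ ⊎ Sat ψ σ τ
Sat (∃¹ φ)   σ τ = Σ Word (λ u → Sat φ (extend u σ) τ)
Sat (∀¹ φ)   σ τ = (u : Word) → Sat φ (extend u σ) τ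
Sat (∃ˢ φ)   σ τ = Σ (FinSet Word) (λ U → Sat φ σ (extend U τ))
Sat (∀ˢ φ)   σ τ = (U : FinSet Word) → Sat φ σ (extend U τ)

noVars : {A : Set} → Fin 0 → A
noVars ()

_⊨_ : {r : ℕ} → Form 0 r → (Fin r → FinSet Word) → Set
φ ⊨ τ = Sat φ noVars τ

-- The weak powerset P^W(Δ₁): universe = finite subsets of ℕ,
-- relations succ (on singletons only) and ⪯ (inclusion).

SuccW : FinSet ℕ → FinSet ℕ → Set
SuccW X Y = Σ ℕ (λ a → (X ≈ˢ [ a ]) × (Y ≈ˢ [ suc a ]))

_⪯_ : FinSet ℕ → FinSet ℕ → Set
X ⪯ Y = X ⊆ Y

pair : {A : Set} → A → A → Fin 2 → A
pair a b zero       = a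
pair a b (suc zero) = b

single : {A : Set} → A → Fin 1 → A
single a zero = a

record Presentation : Set where
  field
    f      : FinSet ℕ → FinSet Word
    f-resp : ∀ X Y → X ≈ˢ Y → f X ≈ˢ f Y
    f-inj  : ∀ X Y → f X ≈ˢ f Y → X ≈ˢ Y
    dom    : Σ (Form 0 1) (λ φ → ∀ Z →
               (φ ⊨ single Z) ⇔ Σ (FinSet ℕ) (λ X → f X ≈ˢ Z))
    succ-def : Σ (Form 0 2) (λ φ → ∀ X Y →
               SuccW X Y ⇔ (φ ⊨ pair (f X) (f Y)))
    ⪯-def    : Σ (Form 0 2) (λ φ → ∀ X Y →
               (X ⪯ Y) ⇔ (φ ⊨ pair (f X) (f Y)))

-- A relation R of arity r on the universe of P^W(Δ₁) is definable in
-- the presentation p (i.e. p is also a presentation of the expansion by R).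
DefinableIn : (p : Presentation) {r : ℕ} → ((Fin r → FinSet ℕ) → Set) → Set
DefinableIn p {r} R = Σ (Form 0 r) (λ φ → ∀ us →
  R us ⇔ (φ ⊨ (Presentation.f p ∘ us)))

-- A relation R definable in one presentation is recognised by a finite
-- automaton that reads the sets position by position; such an automaton is
-- described in P^W(Δ₁) by succ and ⪯ alone, so R is definable in every
-- presentation.
--
-- For recognisability, let A s be the code of {s}, seen as a tree. Pumping in a
-- tree automaton for s ≤ t shows that A s is nowhere much deeper than A t for
-- s ≤ t. Let v be the node at a fixed distance above a deepest node of A n. Below
-- v the codes A s with s ≤ n are small, hence few. Outside v the codes A t with
-- t ≥ n take boundedly many shapes: otherwise pumping below v gives a square of
-- numbers, all of whose subsets would have codes, although an automaton for ∈
-- can tell apart only (states)^side × (sets of states)^side of them. So the node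
-- v transmits bounded information, and the sets below n have boundedly many
-- residuals with respect to R, with a bound that does not depend on n.
--
-- The last part is classical. It is made constructive at the end: the number of
-- states is explicit, and "this automaton decides R" is a WMSO sentence, which is
-- decidable, so the automaton is found by finite search.
module Submission where

open import Defs
open import Data.Nat as ℕ using (ℕ; zero; suc; _+_; _*_; _∸_; _^_; _≤_; _<_; z≤n; s≤s; _⊔_; _≤?_; _<?_)
import Data.Nat.Properties as ℕₚ
open import Data.Bool using (Bool; true; false; not; _∧_; _∨_)
import Data.Bool.Properties as 𝔹ₚ
open import Data.Fin as Fin using (Fin; zero; suc; toℕ; fromℕ<; combine; remQuot; funToFin; finToFun)
import Data.Fin.Properties as Finₚ
open import Data.Fin.Subset using (Subset; ⁅_⁆; _∪_; _⊃_) renaming (_∈_ to _∈ᶠ_)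
open import Data.Fin.Subset.Properties using (x∈⁅x⁆; x∈⁅y⁆⇒x≡y; p⊆p∪q; q⊆p∪q; x∈p∪q⁻) renaming (_∈?_ to _∈ᶠ?_)
open import Data.Fin.Subset.Induction using (⊃-wellFounded; Acc; acc)
open import Data.List using (List; []; _∷_; _++_; [_]; length; take; drop; filter; map; upTo; allFin)
import Data.List.Properties as Listₚ
open import Data.List.Membership.Propositional using (_∈_; _∉_)
import Data.List.Membership.Propositional.Properties as ∈ₚ
open import Data.List.Relation.Unary.Any using (here; there) renaming (any? to any?ᴸ)
import Data.List.Relation.Unary.Any as Any
import Data.List.Relation.Unary.All as All
open import Data.List.Relation.Binary.Subset.Propositional using (_⊆_)
open import Data.Vec as Vec using (Vec; []; _∷_; tabulate; lookup; replicate)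
import Data.Vec.Properties as Vecₚ
open import Data.Product using (∃; ∃₂; _×_; _,_; proj₁; proj₂)
open import Data.Sum using (_⊎_; inj₁; inj₂)
open import Data.Empty using (⊥; ⊥-elim)
open import Data.Unit using (⊤; tt)
open import Function using (_⇔_; _∘_; id; mk⇔; Equivalence)
open import Relation.Nullary using (¬_; Dec; yes; no; does; contradiction)
open import Relation.Nullary.Decidable using (dec-true; dec-false; ¬?; _×-dec_; decidable-stable; ¬¬-excluded-middle) renaming (map to map⇔)
open import Relation.Nullary.Negation using (¬¬-map)
open import Relation.Binary.Definitions using (tri<; tri≈; tri>)
open import Relation.Binary.PropositionalEquality using (_≡_; _≢_; _≗_; refl; sym; trans; cong; cong₂; subst; subst₂)

open Equivalence using (to; from)

-- Labelled binary trees and bottom-up automata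

-- Residuals at different lengths n and n' are compared by grafting: the context of one code around
-- its cut node is joined to the subtree of another code below another cut node. The automaton for
-- the universe certifies that the graft is again a code, and the one for inclusion tells which
-- numbers it contains. The delicate numbers are those above the cut, whose subtrees are not
-- bounded. They are matched, i + n with i + n', by induction on i: the successor automaton yields a
-- common subtree for both codes, inside contexts of the same index. The induction can start because
-- `A n` is small at its cut node; yet all later codes must be tall there, as pumping requires. The
-- constants `slack` and `tallness` reconcile the two demands. A prefix is then classified by the
-- set of observations that its continuations realise. Only the choice of representatives and the
-- decision which observations are realised are classical. All counts are computed from the automata
-- before any choice is made, so the number of states stays outside the double negation.

record Tree {L : Set} (z : L) : Set where
  no-eta-equality
  field
    label  : Word → L
    height : ℕ
    blank  : ∀ w → height ≤ length w → label w ≡ z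
open Tree

infix 4 _≋_
-- The field `height` is only some bound on the support, so it is ignored here. A record, unlike a
-- bare pointwise equation, lets both trees be inferred from the type.
record _≋_ {L : Set} {z : L} (S T : Tree z) : Set where
  constructor pointwise
  field at : label S ≗ label T
open _≋_

≋-refl : {L : Set} {z : L} {T : Tree z} → T ≋ T
≋-refl = pointwise λ _ → refl

≋-sym : {L : Set} {z : L} {S T : Tree z} → S ≋ T → T ≋ S
≋-sym e = pointwise λ w → sym (at e w)

≋-trans : {L : Set} {z : L} {S T U : Tree z} → S ≋ T → T ≋ U → S ≋ U
≋-trans e f = pointwise λ w → trans (at e w) (at f w)

Within : {L : Set} {z : L} → ℕ → Tree z → Set
Within {z = z} d T = ∀ w → d ≤ length w → label T w ≡ z

length-++ˡ : (v w : Word) → length w ≤ length (v ++ w)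
length-++ˡ v w = subst (length w ≤_) (sym (Listₚ.length-++ v)) (ℕₚ.m≤n+m _ _)

sub : {L : Set} {z : L} → Tree z → Word → Tree z
label  (sub T v) w   = label T (v ++ w)
height (sub T v)     = height T
blank  (sub T v) w h = blank T _ (ℕₚ.≤-trans h (length-++ˡ v w))

child : {L : Set} {z : L} → Tree z → Bool → Tree z
child T b = sub T [ b ]

nil : {L : Set} (z : L) → Tree z
label  (nil z) _   = z
height (nil z)     = 0
blank  (nil z) _ _ = refl

nodeLabel : {L : Set} → L → (Word → L) → (Word → L) → Word → L
nodeLabel a l r []          = a
nodeLabel a l r (false ∷ w) = l w
nodeLabel a l r (true ∷ w)  = r w

node : {L : Set} {z : L} → L → Tree z → Tree z → Tree z
label  (node a S T) = nodeLabel a (label S) (label T)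
height (node a S T) = suc (height S ⊔ height T)
blank  (node a S T) (false ∷ w) (s≤s h) = blank S w (ℕₚ.m⊔n≤o⇒m≤o _ _ h)
blank  (node a S T) (true ∷ w)  (s≤s h) = blank T w (ℕₚ.m⊔n≤o⇒n≤o _ _ h)

graftLabel : {L : Set} → Word → (Word → L) → (Word → L) → Word → L
graftLabel []          l m w           = m w
graftLabel (b ∷ v)     l m []          = l []
graftLabel (false ∷ v) l m (false ∷ w) = graftLabel v (l ∘ (false ∷_)) m w
graftLabel (false ∷ v) l m (true ∷ w)  = l (true ∷ w)
graftLabel (true ∷ v)  l m (false ∷ w) = l (false ∷ w)
graftLabel (true ∷ v)  l m (true ∷ w)  = graftLabel v (l ∘ (true ∷_)) m w

pred≤⇒≤suc : ∀ {a n} → ℕ.pred a ≤ n → a ≤ suc n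
pred≤⇒≤suc {zero}  _ = z≤n
pred≤⇒≤suc {suc a} h = s≤s h

module _ {L : Set} {z : L} where

  graftLabel-blank : ∀ v {l m : Word → L} a b
    → (∀ w → a ≤ length w → l w ≡ z) → (∀ w → b ≤ length w → m w ≡ z)
    → ∀ w → a ≤ length w → length v + b ≤ length w → graftLabel v l m w ≡ z
  graftLabel-blank []          a b p q w           _  b≤       = q w b≤
  graftLabel-blank (false ∷ v) a b p q (false ∷ w) a≤ (s≤s b≤) =
    graftLabel-blank v (ℕ.pred a) b (λ u a≤u → p (false ∷ u) (pred≤⇒≤suc a≤u)) q w (ℕₚ.pred-mono-≤ a≤) b≤
  graftLabel-blank (false ∷ v) a b p q (true ∷ w)  a≤ _        = p (true ∷ w) a≤
  graftLabel-blank (true ∷ v)  a b p q (false ∷ w) a≤ _        = p (false ∷ w) a≤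
  graftLabel-blank (true ∷ v)  a b p q (true ∷ w)  a≤ (s≤s b≤) =
    graftLabel-blank v (ℕ.pred a) b (λ u a≤u → p (true ∷ u) (pred≤⇒≤suc a≤u)) q w (ℕₚ.pred-mono-≤ a≤) b≤

  graft : Tree z → Word → Tree z → Tree z
  label  (graft T v Y) = graftLabel v (label T) (label Y)
  height (graft T v Y) = height T ⊔ (length v + height Y)
  blank  (graft T v Y) w h = graftLabel-blank v (height T) (height Y) (blank T) (blank Y) w
    (ℕₚ.m⊔n≤o⇒m≤o _ _ h) (ℕₚ.m⊔n≤o⇒n≤o (height T) _ h)

  graftLabel-cong : ∀ v {l l′ m m′ : Word → L} → l ≗ l′ → m ≗ m′ → graftLabel v l m ≗ graftLabel v l′ m′
  graftLabel-cong []          p q w           = q w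
  graftLabel-cong (b ∷ v)     p q []          = p []
  graftLabel-cong (false ∷ v) p q (false ∷ w) = graftLabel-cong v (p ∘ (false ∷_)) q w
  graftLabel-cong (false ∷ v) p q (true ∷ w)  = p _
  graftLabel-cong (true ∷ v)  p q (false ∷ w) = p _
  graftLabel-cong (true ∷ v)  p q (true ∷ w)  = graftLabel-cong v (p ∘ (true ∷_)) q w

  graftLabel-self : ∀ v (l : Word → L) → graftLabel v l (λ w → l (v ++ w)) ≗ l
  graftLabel-self []          l w           = refl
  graftLabel-self (b ∷ v)     l []          = refl
  graftLabel-self (false ∷ v) l (false ∷ w) = graftLabel-self v (l ∘ (false ∷_)) w
  graftLabel-self (false ∷ v) l (true ∷ w)  = refl
  graftLabel-self (true ∷ v)  l (false ∷ w) = refl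
  graftLabel-self (true ∷ v)  l (true ∷ w)  = graftLabel-self v (l ∘ (true ∷_)) w

  graftLabel-at : ∀ v (l m : Word → L) w → graftLabel v l m (v ++ w) ≡ m w
  graftLabel-at []          l m w = refl
  graftLabel-at (false ∷ v) l m w = graftLabel-at v (l ∘ (false ∷_)) m w
  graftLabel-at (true ∷ v)  l m w = graftLabel-at v (l ∘ (true ∷_)) m w

  graftLabel-twice : ∀ v (l m m′ : Word → L) → graftLabel v (graftLabel v l m) m′ ≗ graftLabel v l m′
  graftLabel-twice []          l m m′ w           = refl
  graftLabel-twice (false ∷ v) l m m′ []          = refl
  graftLabel-twice (true ∷ v)  l m m′ []          = refl
  graftLabel-twice (false ∷ v) l m m′ (false ∷ w) = graftLabel-twice v (l ∘ (false ∷_)) m m′ w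
  graftLabel-twice (false ∷ v) l m m′ (true ∷ w)  = refl
  graftLabel-twice (true ∷ v)  l m m′ (false ∷ w) = refl
  graftLabel-twice (true ∷ v)  l m m′ (true ∷ w)  = graftLabel-twice v (l ∘ (true ∷_)) m m′ w

  sub-cong : ∀ {S T : Tree z} → S ≋ T → ∀ v → sub S v ≋ sub T v
  sub-cong e v = pointwise λ w → at e (v ++ w)

  graft-cong : ∀ {S T X Y : Tree z} v → S ≋ T → X ≋ Y → graft S v X ≋ graft T v Y
  graft-cong v e f = pointwise (graftLabel-cong v (at e) (at f))

  graft-self : ∀ (T : Tree z) v → graft T v (sub T v) ≋ T
  graft-self T v = pointwise (graftLabel-self v (label T))

  sub-graft : ∀ (T : Tree z) v (Y : Tree z) → sub (graft T v Y) v ≋ Y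
  sub-graft T v Y = pointwise (graftLabel-at v (label T) (label Y))

  graft-twice : ∀ (T : Tree z) v (X Y : Tree z) → graft (graft T v X) v Y ≋ graft T v Y
  graft-twice T v X Y = pointwise (graftLabel-twice v (label T) (label X) (label Y))

-- T and T′ agree outside the subtree at v.
SameContext : {L : Set} {z : L} → Word → Tree z → Tree z → Set
SameContext {z = z} v T T′ = ∀ Y → graft T v Y ≋ graft T′ v Y

-- A second graft at v erases the first, so a single pair of fillings already compares the contexts.
-- This also makes `SameContext` decidable.
sameContext : {L : Set} {z : L} {v : Word} {S T X Y : Tree z} → graft S v X ≋ graft T v Y → SameContext v S T
sameContext {v = v} {S} {T} {X} {Y} e Z =
  ≋-trans (≋-sym (graft-twice S v X Z)) (≋-trans (graft-cong v e ≋-refl) (graft-twice T v Y Z))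

-- Trees are total and blank almost everywhere. The law `δ-blank` makes `start` the state of the
-- blank tree, so evaluation may begin at any depth beyond the support.
record Automaton {L : Set} (z : L) : Set where
  field
    size      : ℕ
    δ         : L → Fin size → Fin size → Fin size
    start     : Fin size
    δ-blank   : δ z start start ≡ start
    accepting : Fin size → Bool

module Run {L : Set} {z : L} (A : Automaton z) where
  open Automaton A

  eval : ℕ → (Word → L) → Fin size
  eval zero    l = start
  eval (suc d) l = δ (l []) (eval d (l ∘ (false ∷_))) (eval d (l ∘ (true ∷_)))

  eval-blank : ∀ d {l} → (∀ w → l w ≡ z) → eval d l ≡ start
  eval-blank zero    p = refl
  eval-blank (suc d) p rewrite p [] | eval-blank d (p ∘ (false ∷_)) | eval-blank d (p ∘ (true ∷_)) = δ-blank

  eval-cong : ∀ d {l l′} → l ≗ l′ → eval d l ≡ eval d l′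
  eval-cong zero    p = refl
  eval-cong (suc d) p rewrite p [] | eval-cong d (p ∘ (false ∷_)) | eval-cong d (p ∘ (true ∷_)) = refl

  eval-stable : ∀ {d e l} → d ≤ e → (∀ w → d ≤ length w → l w ≡ z) → eval e l ≡ eval d l
  eval-stable {e = e} z≤n     p = eval-blank e (λ w → p w z≤n)
  eval-stable         (s≤s q) p =
    cong₂ (δ _) (eval-stable q (λ w h → p (false ∷ w) (s≤s h))) (eval-stable q (λ w h → p (true ∷ w) (s≤s h)))

  opaque
    state : Tree z → Fin size
    state T = eval (height T) (label T)

    state-cong : ∀ {S T : Tree z} → S ≋ T → state S ≡ state T
    state-cong {S} {T} e =
      trans (sym (eval-stable (ℕₚ.m≤m⊔n (height S) (height T)) (blank S)))
        (trans (eval-cong (height S ⊔ height T) (at e)) (eval-stable (ℕₚ.m≤n⊔m (height S) (height T)) (blank T)))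

    state-node : ∀ T → state T ≡ δ (label T []) (state (child T false)) (state (child T true))
    state-node T = sym (eval-stable (ℕₚ.n≤1+n (height T)) (blank T))

  context : Word → Tree z → Fin size → Fin size
  context []          T q = q
  context (false ∷ v) T q = δ (label T []) (context v (child T false) q) (state (child T true))
  context (true ∷ v)  T q = δ (label T []) (state (child T false)) (context v (child T true) q)

  -- The basis of every exchange argument below: the part of a tree at v acts on the root only
  -- through its state.
  state-graft : ∀ T v Y → state (graft T v Y) ≡ context v T (state Y)
  state-graft T []          Y = state-cong (pointwise λ _ → refl)
  state-graft T (false ∷ v) Y = trans (state-node (graft T (false ∷ v) Y))
    (cong₂ (δ _)
      (trans (state-cong (pointwise λ _ → refl)) (state-graft (child T false) v Y))
      (state-cong (pointwise λ _ → refl)))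
  state-graft T (true ∷ v)  Y = trans (state-node (graft T (true ∷ v) Y))
    (cong₂ (δ _)
      (state-cong (pointwise λ _ → refl))
      (trans (state-cong (pointwise λ _ → refl)) (state-graft (child T true) v Y)))

  Accepts : Tree z → Set
  Accepts T = accepting (state T) ≡ true

  accepts-cong : ∀ {S T} → S ≋ T → Accepts S → Accepts T
  accepts-cong e = subst (λ q → accepting q ≡ true) (state-cong e)

open Automaton
open Run

does-true : {P : Set} (d : Dec P) → does d ≡ true → P
does-true (yes p) _ = p

bool-ext : {a b : Bool} → (a ≡ true → b ≡ true) → (b ≡ true → a ≡ true) → a ≡ b
bool-ext {true}  {b}     f g = sym (f refl)
bool-ext {false} {true}  f g = g refl
bool-ext {false} {false} f g = refl

not-true : {a : Bool} → ¬ (a ≡ true) → a ≡ false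
not-true {true}  h = ⊥-elim (h refl)
not-true {false} h = refl

infix 4 _≟ʷ_
_≟ʷ_ : (u v : Word) → Dec (u ≡ v)
_≟ʷ_ = Listₚ.≡-dec 𝔹ₚ._≟_

open import Data.List.Membership.DecPropositional _≟ʷ_ using (_∈?_)

-- Finite sets of words as trees

FS : Set
FS = Tree {Bool} false

empty : FS
empty = nil false

maxLength : List Word → ℕ
maxLength []      = 0
maxLength (u ∷ X) = suc (length u) ⊔ maxLength X

∈⇒<maxLength : ∀ {u X} → u ∈ X → length u < maxLength X
∈⇒<maxLength {X = v ∷ X} (here refl) = ℕₚ.m≤m⊔n _ (maxLength X)
∈⇒<maxLength {X = v ∷ X} (there i)   = ℕₚ.≤-trans (∈⇒<maxLength i) (ℕₚ.m≤n⊔m (suc (length v)) _)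

toFS : FinSet Word → FS
label  (toFS X) w   = does (w ∈? X)
height (toFS X)     = maxLength X
blank  (toFS X) w h = dec-false (w ∈? X) (λ i → ℕₚ.<⇒≱ (∈⇒<maxLength i) h)

point : Word → FS
label  (point u) w   = does (w ≟ʷ u)
height (point u)     = suc (length u)
blank  (point u) w h = dec-false (w ≟ʷ u) (λ { refl → ℕₚ.1+n≰n h })

words : ℕ → List Word
words zero    = []
words (suc d) = [] ∷ map (false ∷_) (words d) ++ map (true ∷_) (words d)

∈-words : ∀ {d} w → length w < d → w ∈ words d
∈-words {suc d} []          h       = here refl
∈-words {suc d} (false ∷ w) (s≤s h) = there (∈ₚ.∈-++⁺ˡ (∈ₚ.∈-map⁺ (false ∷_) (∈-words w h)))
∈-words {suc d} (true ∷ w)  (s≤s h) = there (∈ₚ.∈-++⁺ʳ _ (∈ₚ.∈-map⁺ (true ∷_) (∈-words w h)))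

inside-height : {w : Word} (T : FS) → label T w ≡ true → length w < height T
inside-height {w} T e with length w <? height T
... | yes h = h
... | no h  = contradiction (trans (sym e) (blank T w (ℕₚ.≮⇒≥ h))) λ ()

fromFS : FS → FinSet Word
fromFS T = filter (λ w → label T w 𝔹ₚ.≟ true) (words (height T))

∈-fromFS : ∀ {w} T → (w ∈ fromFS T) ⇔ (label T w ≡ true)
∈-fromFS T = mk⇔ (λ i → proj₂ (∈ₚ.∈-filter⁻ (λ w → label T w 𝔹ₚ.≟ true) {xs = words (height T)} i))
  (λ e → ∈ₚ.∈-filter⁺ (λ w → label T w 𝔹ₚ.≟ true) (∈-words _ (inside-height T e)) e)

∈-toFS : ∀ {w} X → (w ∈ X) ⇔ (label (toFS X) w ≡ true)
∈-toFS {w} X = mk⇔ (dec-true (w ∈? X)) (does-true (w ∈? X))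

toFS-fromFS : ∀ T → toFS (fromFS T) ≋ T
toFS-fromFS T = pointwise λ w → bool-ext
  (λ e → to (∈-fromFS T) (from (∈-toFS (fromFS T)) e)) (λ e → to (∈-toFS (fromFS T)) (from (∈-fromFS T) e))

toFS-cong : ∀ {X Y} → X ≈ˢ Y → toFS X ≋ toFS Y
toFS-cong {X} {Y} (p , q) = pointwise λ w → bool-ext
  (λ e → to (∈-toFS Y) (p (from (∈-toFS X) e))) (λ e → to (∈-toFS X) (q (from (∈-toFS Y) e)))

toFS-injective : ∀ {X Y} → toFS X ≋ toFS Y → X ≈ˢ Y
toFS-injective {X} {Y} e =
  (λ {w} i → from (∈-toFS Y) (trans (sym (at e w)) (to (∈-toFS X) i))) ,
  (λ {w} i → from (∈-toFS X) (trans (at e w) (to (∈-toFS Y) i)))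

-- Constructions on automata

bit : Bool → Fin 2
bit false = zero
bit true  = suc zero

unbit : Fin 2 → Bool
unbit zero       = false
unbit (suc zero) = true

unbit-bit : ∀ b → unbit (bit b) ≡ b
unbit-bit false = refl
unbit-bit true  = refl

funToFin-cong : ∀ {m n} {f g : Fin m → Fin n} → f ≗ g → funToFin f ≡ funToFin g
funToFin-cong {zero}  e = refl
funToFin-cong {suc m} e = cong₂ combine (e zero) (funToFin-cong (e ∘ suc))

subset : ∀ {m} → (Fin m → Bool) → Fin (2 ^ m)
subset f = funToFin (bit ∘ f)

member : ∀ {m} → Fin (2 ^ m) → Fin m → Bool
member {m} s q = unbit (finToFun {2} {m} s q)

member-subset : ∀ {m} (f : Fin m → Bool) → member (subset f) ≗ f
member-subset f q = trans (cong unbit (Finₚ.finToFun-funToFin (bit ∘ f) q)) (unbit-bit (f q))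

subset-cong : ∀ {m} {f g : Fin m → Bool} → f ≗ g → subset f ≡ subset g
subset-cong e = funToFin-cong (λ q → cong bit (e q))

module _ {L : Set} {z : L} (A : Automaton z) where

  opaque
    unfolding state

    -- Induction on the height, with the tree and its state carried together: an automaton is
    -- verified by attaching an invariant to each of its states.
    state-induction : (P : Fin (size A) → Tree z → Set)
      → (∀ T → T ≋ nil z → P (start A) T)
      → (∀ T p q → P p (child T false) → P q (child T true) → P (δ A (label T []) p q) T)
      → ∀ T → P (state A T) T
    state-induction P base step T = go (height T) T (blank T)
      where
      go : ∀ d T → (∀ w → d ≤ length w → label T w ≡ z) → P (eval A d (label T)) T
      go zero    T b = base T (pointwise λ w → b w z≤n)
      go (suc d) T b = step T _ _ (go d (child T false) (λ w h → b _ (s≤s h))) (go d (child T true) (λ w h → b _ (s≤s h)))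

  module _ {L′ : Set} {z′ : L′} (B : Automaton z′) (g : L → L′) (h : Fin (size A) → Fin (size B))
    (h-start : h (start A) ≡ start B) (h-δ : ∀ a p q → h (δ A a p q) ≡ δ B (g a) (h p) (h q)) where

    eval-hom : ∀ d {l l′} → (∀ w → l′ w ≡ g (l w)) → h (eval A d l) ≡ eval B d l′
    eval-hom zero    e = h-start
    eval-hom (suc d) {l} {l′} e rewrite e [] | sym (eval-hom d {l ∘ (false ∷_)} (e ∘ (false ∷_))) | sym (eval-hom d {l ∘ (true ∷_)} (e ∘ (true ∷_))) = h-δ _ _ _

    opaque
      unfolding state

      -- Complementation, relabelling and both factors of a product are verified as instances of
      -- this one morphism lemma.
      state-hom : ∀ {S T} → (∀ w → label T w ≡ g (label S w)) → h (state A S) ≡ state B T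
      state-hom {S} {T} e =
        trans (cong h (sym (eval-stable A (ℕₚ.m≤m⊔n (height S) (height T)) (blank S))))
          (trans (eval-hom (height S ⊔ height T) e) (eval-stable B (ℕₚ.m≤n⊔m (height S) (height T)) (blank T)))

  accepts? : ∀ T → Dec (Accepts A T)
  accepts? T = accepting A (state A T) 𝔹ₚ.≟ true

  opaque
    complement : Automaton z
    complement = record { size = size A ; δ = δ A ; start = start A ; δ-blank = δ-blank A ; accepting = not ∘ accepting A }

    accepts-complement : ∀ T → Accepts complement T ⇔ (¬ Accepts A T)
    accepts-complement T rewrite sym (state-hom complement id id refl (λ _ _ _ → refl) {T} {T} (λ _ → refl))
      with accepting A (state A T)
    ... | true  = mk⇔ (λ ()) (λ h → ⊥-elim (h refl))
    ... | false = mk⇔ (λ _ ()) (λ _ → refl)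

  module _ {L′ : Set} (z′ : L′) (g : L′ → L) (g-blank : g z′ ≡ z) where

    relabel : Automaton z′
    relabel = record { size = size A ; δ = δ A ∘ g ; start = start A
      ; δ-blank = trans (cong (λ a → δ A a (start A) (start A)) g-blank) (δ-blank A) ; accepting = accepting A }

module _ {L L′ : Set} {z : L} {z′ : L′} (A : Automaton z) (g : L′ → L) (g-blank : g z′ ≡ z) where

  state-relabel : ∀ {S : Tree z′} {T : Tree z} → (∀ w → label T w ≡ g (label S w)) → state (relabel A z′ g g-blank) S ≡ state A T
  state-relabel e = state-hom (relabel A z′ g g-blank) A g id refl (λ _ _ _ → refl) e

module _ {L : Set} {z : L} (A B : Automaton z) (op : Bool → Bool → Bool) where

  private
    fstₛ : Fin (size A * size B) → Fin (size A)
    fstₛ s = proj₁ (remQuot {size A} (size B) s)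
    sndₛ : Fin (size A * size B) → Fin (size B)
    sndₛ s = proj₂ (remQuot {size A} (size B) s)

    fst-combine : ∀ p q → fstₛ (combine p q) ≡ p
    fst-combine p q = cong proj₁ (Finₚ.remQuot-combine {size A} {size B} p q)
    snd-combine : ∀ p q → sndₛ (combine p q) ≡ q
    snd-combine p q = cong proj₂ (Finₚ.remQuot-combine {size A} {size B} p q)

  opaque
    product : Automaton z
    product = record
      { size = size A * size B
      ; δ = λ a s t → combine (δ A a (fstₛ s) (fstₛ t)) (δ B a (sndₛ s) (sndₛ t))
      ; start = combine (start A) (start B)
      ; δ-blank = cong₂ combine
          (trans (cong₂ (δ A z) (fst-combine (start A) (start B)) (fst-combine (start A) (start B))) (δ-blank A))
          (trans (cong₂ (δ B z) (snd-combine (start A) (start B)) (snd-combine (start A) (start B))) (δ-blank B))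
      ; accepting = λ s → op (accepting A (fstₛ s)) (accepting B (sndₛ s)) }

    accepting-product : ∀ T → accepting product (state product T) ≡ op (accepting A (state A T)) (accepting B (state B T))
    accepting-product T = cong₂ (λ p q → op (accepting A p) (accepting B q))
      (state-hom product A id fstₛ (fst-combine (start A) (start B)) (λ a p q → fst-combine (δ A a (fstₛ p) (fstₛ q)) (δ B a (sndₛ p) (sndₛ q))) {T} {T} (λ _ → refl))
      (state-hom product B id sndₛ (snd-combine (start A) (start B)) (λ a p q → snd-combine (δ A a (fstₛ p) (fstₛ q)) (δ B a (sndₛ p) (sndₛ q))) {T} {T} (λ _ → refl))

∧-true : ∀ {a b} → (a ∧ b ≡ true) ⇔ (a ≡ true × b ≡ true)
∧-true {true}  {b} = mk⇔ (λ e → refl , e) proj₂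
∧-true {false} {b} = mk⇔ (λ ()) (λ ())

∨-true : ∀ {a b} → (a ∨ b ≡ true) ⇔ (a ≡ true ⊎ b ≡ true)
∨-true {true}  {b} = mk⇔ (λ e → inj₁ refl) (λ _ → refl)
∨-true {false} {b} = mk⇔ inj₂ λ { (inj₁ ()) ; (inj₂ e) → e }

module _ {L : Set} {z : L} (A B : Automaton z) where

  accepts-∧ : ∀ T → Accepts (product A B _∧_) T ⇔ (Accepts A T × Accepts B T)
  accepts-∧ T rewrite accepting-product A B _∧_ T = ∧-true

  accepts-∨ : ∀ T → Accepts (product A B _∨_) T ⇔ (Accepts A T ⊎ Accepts B T)
  accepts-∨ T rewrite accepting-product A B _∨_ T = ∨-true

module _ {L : Set} {z : L} (P : L → Bool) (P-blank : P z ≡ false) where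

  somewhere : Automaton z
  somewhere = record
    { size = 2 ; δ = λ a p q → bit (P a ∨ (unbit p ∨ unbit q)) ; start = zero
    ; δ-blank = cong (λ b → bit (b ∨ false)) P-blank ; accepting = unbit }

  accepts-somewhere : ∀ T → Accepts somewhere T ⇔ (∃ λ w → P (label T w) ≡ true)
  accepts-somewhere = state-induction somewhere (λ q T → (unbit q ≡ true) ⇔ (∃ λ w → P (label T w) ≡ true)) base step
    where
    base : ∀ T → T ≋ nil z → (false ≡ true) ⇔ (∃ λ w → P (label T w) ≡ true)
    base T e = mk⇔ (λ ()) (λ { (w , h) → trans (sym P-blank) (trans (cong P (sym (at e w))) h) })
    step : ∀ T p q → (unbit p ≡ true) ⇔ (∃ λ w → P (label T (false ∷ w)) ≡ true)
      → (unbit q ≡ true) ⇔ (∃ λ w → P (label T (true ∷ w)) ≡ true)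
      → (unbit (bit (P (label T []) ∨ (unbit p ∨ unbit q))) ≡ true) ⇔ (∃ λ w → P (label T w) ≡ true)
    step T p q hp hq rewrite unbit-bit (P (label T []) ∨ (unbit p ∨ unbit q)) = mk⇔ there′ back
      where
      there′ : P (label T []) ∨ (unbit p ∨ unbit q) ≡ true → ∃ λ w → P (label T w) ≡ true
      there′ h with to ∨-true h
      ... | inj₁ h₀ = [] , h₀
      ... | inj₂ h′ with to (∨-true {unbit p}) h′
      ... | inj₁ h₁ = false ∷ proj₁ (to hp h₁) , proj₂ (to hp h₁)
      ... | inj₂ h₂ = true ∷ proj₁ (to hq h₂) , proj₂ (to hq h₂)
      back : (∃ λ w → P (label T w) ≡ true) → P (label T []) ∨ (unbit p ∨ unbit q) ≡ true
      back ([] , h)        = from ∨-true (inj₁ h)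
      back (false ∷ w , h) = from (∨-true {P (label T [])}) (inj₂ (from (∨-true {unbit p}) (inj₁ (from hp (w , h)))))
      back (true ∷ w , h)  = from (∨-true {P (label T [])}) (inj₂ (from (∨-true {unbit p}) (inj₂ (from hq (w , h)))))

  private
    -- Saturating addition: the three states stand for no node, exactly one node and at least two
    -- nodes.
    add : Bool → Fin 3 → Fin 3 → Fin 3
    add true  zero    zero    = suc zero
    add true  zero    (suc _) = suc (suc zero)
    add true  (suc _) _       = suc (suc zero)
    add false zero    q       = q
    add false (suc p) zero    = suc p
    add false (suc _) (suc _) = suc (suc zero)

    isOne : Fin 3 → Bool
    isOne (suc zero) = true
    isOne _          = false

    Count : Fin 3 → Tree z → Set
    Count zero             T = ∀ w → P (label T w) ≡ false
    Count (suc zero)       T = ∃ λ u → ∀ w → P (label T w) ≡ does (w ≟ʷ u)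
    Count (suc (suc zero)) T = ∃₂ λ u v → u ≢ v × P (label T u) ≡ true × P (label T v) ≡ true

    some : ∀ p T → Count (suc p) T → ∃ λ w → P (label T w) ≡ true
    some zero       T (u , h)             = u , trans (h u) (dec-true (u ≟ʷ u) refl)
    some (suc zero) T (u , v , _ , h , _) = u , h

  private
    once′ : Automaton z
    once′ = record { size = 3 ; δ = λ a → add (P a) ; start = zero
      ; δ-blank = cong (λ b → add b zero zero) P-blank ; accepting = isOne }

  private
    does-∷ : ∀ b u w → does (w ≟ʷ u) ≡ does (b ∷ w ≟ʷ b ∷ u)
    does-∷ b u w = bool-ext
      (λ h → dec-true (b ∷ w ≟ʷ b ∷ u) (cong (b ∷_) (does-true (w ≟ʷ u) h)))
      (λ h → dec-true (w ≟ʷ u) (Listₚ.∷-injectiveʳ (does-true (b ∷ w ≟ʷ b ∷ u) h)))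

    count-step : ∀ T p q b → P (label T []) ≡ b → Count p (child T false) → Count q (child T true) → Count (add b p q) T
    count-step T zero zero true e hp hq = [] , λ { [] → e ; (false ∷ w) → hp w ; (true ∷ w) → hq w }
    count-step T zero (suc q) true e hp hq =
      let w , h = some q (child T true) hq in [] , true ∷ w , (λ ()) , e , h
    count-step T (suc p) q true e hp hq =
      let w , h = some p (child T false) hp in [] , false ∷ w , (λ ()) , e , h
    count-step T zero zero false e hp hq = λ { [] → e ; (false ∷ w) → hp w ; (true ∷ w) → hq w }
    count-step T zero (suc zero) false e hp (u , h) = true ∷ u ,
      λ { [] → e ; (false ∷ w) → hp w ; (true ∷ w) → trans (h w) (does-∷ true u w) }
    count-step T zero (suc (suc zero)) false e hp (u , v , u≢v , hu , hv) =
      true ∷ u , true ∷ v , (λ r → u≢v (Listₚ.∷-injectiveʳ r)) , hu , hv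
    count-step T (suc zero) zero false e (u , h) hq = false ∷ u ,
      λ { [] → e ; (true ∷ w) → hq w ; (false ∷ w) → trans (h w) (does-∷ false u w) }
    count-step T (suc (suc zero)) zero false e (u , v , u≢v , hu , hv) hq =
      false ∷ u , false ∷ v , (λ r → u≢v (Listₚ.∷-injectiveʳ r)) , hu , hv
    count-step T (suc p) (suc q) false e hp hq =
      let w , h = some p (child T false) hp
          w′ , h′ = some q (child T true) hq in false ∷ w , true ∷ w′ , (λ ()) , h , h′

    count : ∀ T → Count (state once′ T) T
    count = state-induction once′ Count (λ T e w → trans (cong P (at e w)) P-blank)
      (λ T p q → count-step T p q (P (label T [])) refl)

  opaque
    once : Automaton z
    once = once′

    accepts-once : ∀ T → Accepts once T ⇔ (∃ λ u → ∀ w → P (label T w) ≡ does (w ≟ʷ u))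
    accepts-once T with state once′ T | count T
    ... | zero           | h = mk⇔ (λ ()) λ { (u , k) → trans (sym (h u)) (trans (k u) (dec-true (u ≟ʷ u) refl)) }
    ... | suc zero       | h = mk⇔ (λ _ → h) (λ _ → refl)
    ... | suc (suc zero) | u , v , u≢v , hu , hv = mk⇔ (λ ()) λ { (x , k) → ⊥-elim (u≢v
          (trans (does-true (u ≟ʷ x) (trans (sym (k u)) hu)) (sym (does-true (v ≟ʷ x) (trans (sym (k v)) hv))))) }

module _ {L : Set} {z : L} (b : Bool) (P Q : L → Bool) (P-blank : P z ≡ false) (Q-blank : Q z ≡ false) where

  private
    isOne isTwo : Fin 3 → Bool
    isOne (suc zero)       = true
    isOne _                = false
    isTwo (suc (suc zero)) = true
    isTwo _                = false

    mk : Bool → Bool → Fin 3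
    mk true  _     = suc (suc zero)
    mk false true  = suc zero
    mk false false = zero

    pick : Bool → Fin 3 → Fin 3 → Fin 3
    pick false p q = p
    pick true  p q = q

    isTwo-mk : ∀ x y → isTwo (mk x y) ≡ x
    isTwo-mk true  y     = refl
    isTwo-mk false true  = refl
    isTwo-mk false false = refl

    isOne-mk : ∀ x y → isTwo (mk x y) ≡ false → isOne (mk x y) ≡ y
    isOne-mk true  y     ()
    isOne-mk false true  _ = refl
    isOne-mk false false _ = refl

    one⇒¬two : ∀ s → isOne s ≡ true → isTwo s ≡ false
    one⇒¬two (suc zero) _ = refl

  -- State two records that an edge was found. State one says that none was found and that the root
  -- satisfies `Q`, which the parent needs to know. State two may forget `Q` at the root because
  -- acceptance is already settled.
  edge : Automaton z
  edge = record { size = 3 ; start = zero ; accepting = isTwo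
    ; δ = λ a p q → mk (isTwo p ∨ (isTwo q ∨ (P a ∧ isOne (pick b p q)))) (Q a)
    ; δ-blank = cong₂ (λ x y → mk (x ∧ isOne (pick b zero zero)) y) P-blank Q-blank }

  private
    Edge : Tree z → Set
    Edge T = ∃ λ w → P (label T w) ≡ true × Q (label T (w ++ [ b ])) ≡ true

    Correct : Fin 3 → Tree z → Set
    Correct s T = ((isTwo s ≡ true) ⇔ Edge T) × (isTwo s ≡ false → isOne s ≡ Q (label T []))

    root : ∀ b′ T p q → Correct p (child T false) → Correct q (child T true) → Correct (pick b′ p q) (child T b′)
    root false T p q hp hq = hp
    root true  T p q hp hq = hq

    two-or : ∀ b′ p q {x} → isTwo (pick b′ p q) ≡ true → isTwo p ∨ (isTwo q ∨ x) ≡ true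
    two-or false p q h = from ∨-true (inj₁ h)
    two-or true  p q h = from (∨-true {isTwo p}) (inj₂ (from ∨-true (inj₁ h)))

    correct : ∀ T → Correct (state edge T) T
    correct = state-induction edge Correct
      (λ T e → mk⇔ (λ ()) (λ { (w , h , _) → trans (sym P-blank) (trans (cong P (sym (at e w))) h) })
             , (λ _ → sym (trans (cong Q (at e [])) Q-blank)))
      λ T p q hp hq →
        let r = root b T p q hp hq
            x = isTwo p ∨ (isTwo q ∨ (P (label T []) ∧ isOne (pick b p q)))
            there′ : x ≡ true → Edge T
            there′ h = case₁ T p q hp hq r (to (∨-true {isTwo p}) h)
        in mk⇔ (λ h → there′ (trans (sym (isTwo-mk x (Q (label T [])))) h))
               (λ h → trans (isTwo-mk x (Q (label T []))) (back T p q hp hq r h))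
           , isOne-mk x (Q (label T []))
      where
      case₁ : ∀ T p q → Correct p (child T false) → Correct q (child T true) → Correct (pick b p q) (child T b)
        → isTwo p ≡ true ⊎ isTwo q ∨ (P (label T []) ∧ isOne (pick b p q)) ≡ true → Edge T
      case₁ T p q hp hq r (inj₁ h) = let w , k = to (proj₁ hp) h in false ∷ w , k
      case₁ T p q hp hq r (inj₂ h) with to (∨-true {isTwo q}) h
      ... | inj₁ h₁ = let w , k = to (proj₁ hq) h₁ in true ∷ w , k
      ... | inj₂ h₂ = let h₃ , h₄ = to (∧-true {P (label T [])}) h₂ in
        [] , h₃ , trans (sym (proj₂ r (one⇒¬two _ h₄))) h₄
      back : ∀ T p q → Correct p (child T false) → Correct q (child T true) → Correct (pick b p q) (child T b)
        → Edge T → isTwo p ∨ (isTwo q ∨ (P (label T []) ∧ isOne (pick b p q))) ≡ true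
      back T p q hp hq r (false ∷ w , k) = two-or false p q (from (proj₁ hp) (w , k))
      back T p q hp hq r (true ∷ w , k)  = two-or true p q (from (proj₁ hq) (w , k))
      back T p q hp hq r ([] , h , k) with isTwo (pick b p q) in e
      ... | true  = two-or b p q e
      ... | false = from (∨-true {isTwo p}) (inj₂ (from (∨-true {isTwo q}) (inj₂ (from ∧-true (h , trans (proj₂ r refl) k)))))

  accepts-edge : ∀ T → Accepts edge T ⇔ (∃ λ w → P (label T w) ≡ true × Q (label T (w ++ [ b ])) ≡ true)
  accepts-edge T = proj₁ (correct T)

overlay : {L L′ : Set} {z : L} {z′ : L′} (ins : Bool → L → L′) → ins false z ≡ z′ → FS → Tree z → Tree z′
label  (overlay ins e U T) w   = ins (label U w) (label T w)
height (overlay ins e U T)     = height U ⊔ height T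
blank  (overlay ins e U T) w h =
  trans (cong₂ ins (blank U w (ℕₚ.m⊔n≤o⇒m≤o (height U) (height T) h)) (blank T w (ℕₚ.m⊔n≤o⇒n≤o (height U) (height T) h))) e

∃Bool? : {P : Bool → Set} → (∀ b → Dec (P b)) → Dec (∃ P)
∃Bool? P? with P? false | P? true
... | yes p | _     = yes (false , p)
... | no _  | yes q = yes (true , q)
... | no p  | no q  = no λ { (false , h) → p h ; (true , h) → q h }

-- Existential quantification over a track: the subset construction, started
-- in the set of states reached by marking nodes of a blank tree.
module Projection {L L′ : Set} {z : L} {z′ : L′} (A : Automaton z′) (ins : Bool → L → L′) (ins-blank : ins false z ≡ z′) where

  mark : FS → Tree z → Tree z′
  mark = overlay ins ins-blank

  Reaches : Tree z → Fin (size A) → Set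
  Reaches T q = ∃ λ U → state A (mark U T) ≡ q

  reaches-cong : ∀ {S T q} → S ≋ T → Reaches S q → Reaches T q
  reaches-cong e (U , h) = U , trans (state-cong A (pointwise λ w → cong (ins (label U w)) (sym (at e w)))) h

  state-mark : ∀ U T → state A (mark U T) ≡
    δ A (ins (label U []) (label T [])) (state A (mark (child U false) (child T false))) (state A (mark (child U true) (child T true)))
  state-mark U T = trans (state-node A (mark U T))
    (cong₂ (δ A _) (state-cong A (pointwise λ _ → refl)) (state-cong A (pointwise λ _ → refl)))

  reaches-node : ∀ T b {p q} → Reaches (child T false) p → Reaches (child T true) q → Reaches T (δ A (ins b (label T [])) p q)
  reaches-node T b (U , refl) (V , refl) = node b U V , trans (state-mark (node b U V) T)
    (cong₂ (δ A _) (state-cong A (pointwise λ _ → refl)) (state-cong A (pointwise λ _ → refl)))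

  Closed : Subset (size A) → Set
  Closed S = ∀ b {p q} → p ∈ᶠ S → q ∈ᶠ S → δ A (ins b z) p q ∈ᶠ S

  -- Marks may lie at any depth of the blank part, so the start set has to be exactly the set of
  -- states that marked blank trees reach. It is obtained as a least fixed point: states are added
  -- one at a time, each with a witnessing tree, and strict growth inside a finite set terminates.
  closure : (S : Subset (size A)) → Acc _⊃_ S → start A ∈ᶠ S → (∀ {q} → q ∈ᶠ S → Reaches (nil z) q)
    → ∃ λ S′ → start A ∈ᶠ S′ × (∀ {q} → q ∈ᶠ S′ → Reaches (nil z) q) × Closed S′
  closure S (acc rec) st sound
    with ∃Bool? (λ b → Finₚ.any? (λ p → Finₚ.any? (λ q → (p ∈ᶠ? S) ×-dec ((q ∈ᶠ? S) ×-dec ¬? (δ A (ins b z) p q ∈ᶠ? S)))))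
  ... | no none = S , st , sound , λ b {p} {q} hp hq →
          decidable-stable (δ A (ins b z) p q ∈ᶠ? S) (λ n → none (b , p , q , hp , hq , n))
  ... | yes (b , p , q , hp , hq , n) = closure (S ∪ ⁅ new ⁆) (rec bigger) (p⊆p∪q _ st) sound′
    where
    new = δ A (ins b z) p q
    bigger : (S ∪ ⁅ new ⁆) ⊃ S
    bigger = p⊆p∪q _ , new , q⊆p∪q S _ (x∈⁅x⁆ new) , n
    sound′ : ∀ {q} → q ∈ᶠ S ∪ ⁅ new ⁆ → Reaches (nil z) q
    sound′ {q′} i with x∈p∪q⁻ S _ i
    ... | inj₁ j = sound j
    ... | inj₂ j = subst (Reaches (nil z)) (sym (x∈⁅y⁆⇒x≡y new j))
                     (reaches-node (nil z) b (child-nil {false} (sound hp)) (child-nil {true} (sound hq)))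
      where
      child-nil : ∀ {b q} → Reaches (nil z) q → Reaches (child (nil z) b) q
      child-nil {b} = reaches-cong {nil z} {child (nil z) b} (pointwise λ _ → refl)

  private
    closed = closure ⁅ start A ⁆ (⊃-wellFounded _) (x∈⁅x⁆ _)
      (λ i → subst (Reaches (nil z)) (sym (x∈⁅y⁆⇒x≡y _ i))
        (empty , state-blank))
      where
      state-blank : state A (mark empty (nil z)) ≡ start A
      state-blank = state-induction A (λ q T → T ≋ nil z′ → q ≡ start A) (λ _ _ _ → refl)
        (λ T p q hp hq e → trans (cong₂ (δ A (label T [])) (hp (≋-trans (sub-cong e [ false ]) (pointwise λ _ → refl)))
            (hq (≋-trans (sub-cong e [ true ]) (pointwise λ _ → refl))))
          (trans (cong (λ a → δ A a (start A) (start A)) (at e [])) (δ-blank A)))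
        (mark empty (nil z)) (pointwise λ _ → ins-blank)

  blankStates : Subset (size A)
  blankStates = proj₁ closed

  complete : ∀ U → state A (mark U (nil z)) ∈ᶠ blankStates
  complete U = subst (_∈ᶠ blankStates) (state-cong A (pointwise λ _ → refl))
    (state-induction A (λ q T → (∃ λ U → T ≋ mark U (nil z)) → q ∈ᶠ blankStates)
      (λ _ _ _ → proj₁ (proj₂ closed))
      (λ T p q hp hq (U , e) → subst (λ a → δ A a p q ∈ᶠ blankStates) (sym (at e []))
        (proj₂ (proj₂ (proj₂ closed)) (label U [])
          (hp (child U false , ≋-trans (sub-cong e [ false ]) (pointwise λ _ → refl)))
          (hq (child U true , ≋-trans (sub-cong e [ true ]) (pointwise λ _ → refl)))))
      (mark U (nil z)) (U , ≋-refl))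

  Step : Fin (2 ^ size A) → Fin (2 ^ size A) → L → Fin (size A) → Set
  Step s t a r = ∃ λ b → ∃ λ p → ∃ λ q → (member s p ≡ true) × (member t q ≡ true) × (δ A (ins b a) p q ≡ r)

  step? : ∀ s t a r → Dec (Step s t a r)
  step? s t a r = ∃Bool? λ b → Finₚ.any? λ p → Finₚ.any? λ q →
    (member s p 𝔹ₚ.≟ true) ×-dec ((member t q 𝔹ₚ.≟ true) ×-dec (δ A (ins b a) p q Finₚ.≟ r))

  private
    s₀ : Fin (2 ^ size A)
    s₀ = subset (λ q → does (q ∈ᶠ? blankStates))

    member-s₀ : ∀ {q} → (member s₀ q ≡ true) ⇔ (q ∈ᶠ blankStates)
    member-s₀ {q} rewrite member-subset (λ q → does (q ∈ᶠ? blankStates)) q =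
      mk⇔ (does-true (q ∈ᶠ? blankStates)) (dec-true (q ∈ᶠ? blankStates))

    accept? : (s : Fin (2 ^ size A)) → Dec (∃ λ q → (member s q ≡ true) × (accepting A q ≡ true))
    accept? s = Finₚ.any? λ q → (member s q 𝔹ₚ.≟ true) ×-dec (accepting A q 𝔹ₚ.≟ true)

  reaches-blank : ∀ {q} → Reaches (nil z) q ⇔ (q ∈ᶠ blankStates)
  reaches-blank = mk⇔ (λ { (U , refl) → complete U }) (proj₁ (proj₂ (proj₂ closed)))

  projection′ : Automaton z
  projection′ = record { size = 2 ^ size A ; start = s₀
    ; δ = λ a s t → subset (λ r → does (step? s t a r))
    -- One inclusion is closedness; for the other, a marked blank tree is split at its root.
    ; δ-blank = subset-cong (λ r → bool-ext
        (λ h → let b , p , q , hp , hq , e = does-true (step? s₀ s₀ z r) h in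
          dec-true (r ∈ᶠ? blankStates) (subst (_∈ᶠ blankStates) e
            (proj₂ (proj₂ (proj₂ closed)) b (to member-s₀ hp) (to member-s₀ hq))))
        (λ h → dec-true (step? s₀ s₀ z r) (blank-step r (does-true (r ∈ᶠ? blankStates) h))))
    ; accepting = λ s → does (accept? s) }
    where
    blank-step : ∀ r → r ∈ᶠ blankStates → Step s₀ s₀ z r
    blank-step r i with from reaches-blank i
    ... | U , e = label U [] , _ , _ ,
      from member-s₀ (complete (child U false)) , from member-s₀ (complete (child U true)) ,
      trans (cong₂ (δ A _) (state-cong A (pointwise λ _ → refl)) (state-cong A (pointwise λ _ → refl)))
        (trans (sym (state-mark U (nil z))) e)

  member-projection : ∀ T {q} → (member (state projection′ T) q ≡ true) ⇔ Reaches T q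
  member-projection = state-induction projection′ (λ s T → ∀ {q} → (member s q ≡ true) ⇔ Reaches T q)
    (λ T e → mk⇔ (λ h → reaches-cong (≋-sym e) (from reaches-blank (to member-s₀ h)))
                 (λ h → from member-s₀ (to reaches-blank (reaches-cong e h))))
    λ T s t hs ht {r} → mk⇔
      (λ h → let b , p , q , hp , hq , e = does-true (step? s t (label T []) r)
                   (trans (sym (member-subset (λ r → does (step? s t (label T []) r)) r)) h)
             in subst (Reaches T) e (reaches-node T b (to hs hp) (to ht hq)))
      (λ { (U , refl) → trans (member-subset (λ r → does (step? s t (label T []) r)) r)
             (dec-true (step? s t (label T []) r) (label U [] , _ , _ ,
               from hs (child U false , refl) , from ht (child U true , refl) , sym (state-mark U T))) })

  opaque
    projection : Automaton z
    projection = projection′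

    accepts-projection : ∀ T → Accepts projection T ⇔ (∃ λ U → Accepts A (mark U T))
    accepts-projection T = mk⇔
      (λ h → let q , hq , a = does-true (accept? (state projection′ T)) h
                 U , e = to (member-projection T) hq
             in U , trans (cong (accepting A) e) a)
      (λ (U , a) → dec-true (accept? (state projection′ T)) (_ , from (member-projection T) (U , refl) , a))

open Projection using (projection; accepts-projection)

-- WMSO formulas as automata: a first-order variable is a track with a single mark.

maxᶠ : ∀ {k} → (Fin k → ℕ) → ℕ
maxᶠ {zero}  h = 0
maxᶠ {suc k} h = h zero ⊔ maxᶠ (h ∘ suc)

≤maxᶠ : ∀ {k} (h : Fin k → ℕ) i → h i ≤ maxᶠ h
≤maxᶠ h zero    = ℕₚ.m≤m⊔n _ _
≤maxᶠ h (suc i) = ℕₚ.≤-trans (≤maxᶠ (h ∘ suc) i) (ℕₚ.m≤n⊔m (h zero) _)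

tabulate-const : ∀ k {f : Fin k → Bool} → (∀ i → f i ≡ false) → tabulate f ≡ replicate k false
tabulate-const zero    e = refl
tabulate-const (suc k) e = cong₂ _∷_ (e zero) (tabulate-const k (e ∘ suc))

tracks : ∀ {k} → (Fin k → FS) → Tree (replicate k false)
label  (tracks ts) w   = tabulate (λ i → label (ts i) w)
height (tracks ts)     = maxᶠ (height ∘ ts)
blank  (tracks ts) w h = tabulate-const _ (λ i → blank (ts i) w (ℕₚ.≤-trans (≤maxᶠ (height ∘ ts) i) h))

tracks-cong : ∀ {k} {ss ts : Fin k → FS} → (∀ i → ss i ≋ ts i) → tracks ss ≋ tracks ts
tracks-cong e = pointwise λ w → Vecₚ.tabulate-cong (λ i → at (e i) w)

Letter : ℕ → ℕ → Set
Letter m n = Vec Bool m × Vec Bool n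

blankLetter : ∀ m n → Letter m n
blankLetter m n = replicate m false , replicate n false

environment : ∀ {m n} → (Fin m → Word) → (Fin n → FS) → Tree (blankLetter m n)
label  (environment σ ts) w   = label (tracks (point ∘ σ)) w , label (tracks ts) w
height (environment σ ts)     = height (tracks (point ∘ σ)) ⊔ height (tracks ts)
blank  (environment σ ts) w h = cong₂ _,_ (blank (tracks (point ∘ σ)) w (ℕₚ.m⊔n≤o⇒m≤o _ _ h))
  (blank (tracks ts) w (ℕₚ.m⊔n≤o⇒n≤o (height (tracks (point ∘ σ))) _ h))

fo : ∀ {m n} → Fin m → Letter m n → Bool
fo x a = lookup (proj₁ a) x

so : ∀ {m n} → Fin n → Letter m n → Bool
so X a = lookup (proj₂ a) X

fo-blank : ∀ {m n} (x : Fin m) → fo x (blankLetter m n) ≡ false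
fo-blank x = Vecₚ.lookup-replicate x false

addFO : ∀ {m n} → Bool → Letter m n → Letter (suc m) n
addFO b (xs , Xs) = b ∷ xs , Xs

addSO : ∀ {m n} → Bool → Letter m n → Letter m (suc n)
addSO b (xs , Xs) = xs , b ∷ Xs

singleton₀ : ∀ {m n} → Automaton (blankLetter (suc m) n)
singleton₀ {m} {n} = once (fo {suc m} {n} zero) refl

exists₁ : ∀ {m n} → Automaton (blankLetter (suc m) n) → Automaton (blankLetter m n)
exists₁ A = projection (product A singleton₀ _∧_) addFO refl

existsₛ : ∀ {m n} → Automaton (blankLetter m (suc n)) → Automaton (blankLetter m n)
existsₛ A = projection A addSO refl

automaton : ∀ {m n} → Form m n → Automaton (blankLetter m n)
automaton {m} {n} (x ∈′ X) = somewhere (λ a → fo x a ∧ so X a) (cong (_∧ so X (blankLetter m n)) (fo-blank {m} {n} x))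
automaton {m} {n} (x ≐ y)  = somewhere (λ a → fo x a ∧ fo y a) (cong (_∧ fo y (blankLetter m n)) (fo-blank {m} {n} x))
automaton {m} {n} (S₀ x y) = edge false (fo {m} {n} x) (fo {m} {n} y) (fo-blank {m} {n} x) (fo-blank {m} {n} y)
automaton {m} {n} (S₁ x y) = edge true (fo {m} {n} x) (fo {m} {n} y) (fo-blank {m} {n} x) (fo-blank {m} {n} y)
automaton (¬′ φ)   = complement (automaton φ)
automaton (φ ∧′ ψ) = product (automaton φ) (automaton ψ) _∧_
automaton (φ ∨′ ψ) = product (automaton φ) (automaton ψ) _∨_
automaton (∃¹ φ)   = exists₁ (automaton φ)
automaton (∀¹ φ)   = complement (exists₁ (complement (automaton φ)))
automaton (∃ˢ φ)   = existsₛ (automaton φ)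
automaton (∀ˢ φ)   = complement (existsₛ (complement (automaton φ)))

fo-environment : ∀ {m n} (σ : Fin m → Word) (ts : Fin n → FS) x w → fo x (label (environment σ ts) w) ≡ does (w ≟ʷ σ x)
fo-environment σ ts x w = Vecₚ.lookup∘tabulate _ x

so-environment : ∀ {m n} (σ : Fin m → Word) (ts : Fin n → FS) X w → so X (label (environment σ ts) w) ≡ label (ts X) w
so-environment σ ts X w = Vecₚ.lookup∘tabulate _ X

fo-true : ∀ {m n} (σ : Fin m → Word) (ts : Fin n → FS) x w → (fo x (label (environment σ ts) w) ≡ true) ⇔ (w ≡ σ x)
fo-true σ ts x w rewrite fo-environment σ ts x w = mk⇔ (does-true (w ≟ʷ σ x)) (dec-true (w ≟ʷ σ x))

marked : ∀ {m n} → FS → (Fin m → Word) → (Fin n → FS) → Tree (blankLetter (suc m) n)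
marked U σ ts = overlay addFO refl U (environment σ ts)

accepts-singleton₀ : ∀ {m n} (T : Tree (blankLetter (suc m) n)) →
  Accepts singleton₀ T ⇔ (∃ λ u → ∀ w → fo {suc m} {n} zero (label T w) ≡ does (w ≟ʷ u))
accepts-singleton₀ {m} {n} = accepts-once (fo {suc m} {n} zero) refl

marked-point : ∀ {m n} U u (σ : Fin m → Word) (ts : Fin n → FS) → (∀ w → label U w ≡ does (w ≟ʷ u))
  → marked U σ ts ≋ environment (extend u σ) ts
marked-point U u σ ts e = pointwise λ w → cong (λ b → addFO b (label (environment σ ts) w)) (e w)

accepts-exists₁ : ∀ {m n} (A : Automaton (blankLetter (suc m) n)) (σ : Fin m → Word) (ts : Fin n → FS) →
  Accepts (exists₁ A) (environment σ ts) ⇔ (∃ λ u → Accepts A (environment (extend u σ) ts))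
accepts-exists₁ {m} {n} A σ ts = mk⇔ there′ back
  where
  B = product A (singleton₀ {m} {n}) _∧_
  there′ : Accepts (exists₁ A) (environment σ ts) → ∃ λ u → Accepts A (environment (extend u σ) ts)
  there′ h with to (accepts-projection B addFO refl (environment σ ts)) h
  ... | U , a with to (accepts-∧ A singleton₀ (marked U σ ts)) a
  ... | aA , a₁ with to (accepts-singleton₀ (marked U σ ts)) a₁
  ... | u , e = u , accepts-cong A (marked-point U u σ ts e) aA
  back : (∃ λ u → Accepts A (environment (extend u σ) ts)) → Accepts (exists₁ A) (environment σ ts)
  back (u , h) = from (accepts-projection B addFO refl (environment σ ts))
    (point u , from (accepts-∧ A singleton₀ (marked (point u) σ ts))
      (accepts-cong A (≋-sym (marked-point (point u) u σ ts (λ _ → refl))) h ,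
       from (accepts-singleton₀ (marked (point u) σ ts)) (u , λ _ → refl)))

accepts-existsₛ : ∀ {m n} (A : Automaton (blankLetter m (suc n))) (σ : Fin m → Word) (ts : Fin n → FS) →
  Accepts (existsₛ A) (environment σ ts) ⇔ (∃ λ U → Accepts A (environment σ (extend U ts)))
accepts-existsₛ A σ ts = mk⇔
  (λ h → let U , a = to (accepts-projection A addSO refl (environment σ ts)) h
         in U , accepts-cong A {overlay addSO refl U (environment σ ts)} (pointwise λ _ → refl) a)
  (λ (U , h) → from (accepts-projection A addSO refl (environment σ ts))
    (U , accepts-cong A {T = overlay addSO refl U (environment σ ts)} (pointwise λ _ → refl) h))

⇔-trans : {A B C : Set} → A ⇔ B → B ⇔ C → A ⇔ C
⇔-trans f g = mk⇔ (to g ∘ to f) (from f ∘ from g)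

⇔-sym : {A B : Set} → A ⇔ B → B ⇔ A
⇔-sym f = mk⇔ (from f) (to f)

¬-cong : {A B : Set} → A ⇔ B → (¬ A) ⇔ (¬ B)
¬-cong f = mk⇔ (_∘ from f) (_∘ to f)

-- Decidability of P replaces excluded middle. Acceptance is decidable, so universal quantifiers
-- reduce constructively to projection and complement.
∀⇔¬∃¬ : {A : Set} {P : A → Set} → (∀ a → Dec (P a)) → (¬ ∃ λ a → ¬ P a) ⇔ (∀ a → P a)
∀⇔¬∃¬ P? = mk⇔ (λ h a → decidable-stable (P? a) (λ n → h (a , n))) (λ h (a , n) → n (h a))

-- The set quantifiers of Sat range over lists, those of the automaton over trees.
automaton-correct : ∀ {m n} (φ : Form m n) σ (ts : Fin n → FS) τ → (∀ i → ts i ≋ toFS (τ i))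
  → Accepts (automaton φ) (environment σ ts) ⇔ Sat φ σ τ
automaton-correct (x ∈′ X) σ ts τ e = ⇔-trans (accepts-somewhere (λ a → fo x a ∧ so X a) _ _) (mk⇔
  (λ (w , h) → let h₁ , h₂ = to ∧-true h in subst (_∈ τ X) (to (fo-true σ ts x w) h₁)
    (from (∈-toFS (τ X)) (trans (sym (at (e X) w)) (trans (sym (so-environment σ ts X w)) h₂))))
  (λ h → σ x , from ∧-true (from (fo-true σ ts x _) refl ,
    trans (so-environment σ ts X _) (trans (at (e X) _) (to (∈-toFS (τ X)) h)))))
automaton-correct (x ≐ y) σ ts τ e = ⇔-trans (accepts-somewhere (λ a → fo x a ∧ fo y a) _ _) (mk⇔
  (λ (w , h) → let h₁ , h₂ = to ∧-true h in trans (sym (to (fo-true σ ts x w) h₁)) (to (fo-true σ ts y w) h₂))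
  (λ h → σ x , from ∧-true (from (fo-true σ ts x _) refl , from (fo-true σ ts y _) h)))
automaton-correct (S₀ x y) σ ts τ e = ⇔-trans (accepts-edge false (fo x) (fo y) _ _ _) (mk⇔
  (λ (w , h₁ , h₂) → trans (sym (to (fo-true σ ts y _) h₂)) (cong (_++ [ false ]) (to (fo-true σ ts x w) h₁)))
  (λ h → σ x , from (fo-true σ ts x _) refl , from (fo-true σ ts y _) (sym h)))
automaton-correct (S₁ x y) σ ts τ e = ⇔-trans (accepts-edge true (fo x) (fo y) _ _ _) (mk⇔
  (λ (w , h₁ , h₂) → trans (sym (to (fo-true σ ts y _) h₂)) (cong (_++ [ true ]) (to (fo-true σ ts x w) h₁)))
  (λ h → σ x , from (fo-true σ ts x _) refl , from (fo-true σ ts y _) (sym h)))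
automaton-correct (¬′ φ) σ ts τ e = ⇔-trans (accepts-complement (automaton φ) _) (¬-cong (automaton-correct φ σ ts τ e))
automaton-correct (φ ∧′ ψ) σ ts τ e = ⇔-trans (accepts-∧ (automaton φ) (automaton ψ) _) (mk⇔
  (λ (h , k) → to (automaton-correct φ σ ts τ e) h , to (automaton-correct ψ σ ts τ e) k)
  (λ (h , k) → from (automaton-correct φ σ ts τ e) h , from (automaton-correct ψ σ ts τ e) k))
automaton-correct (φ ∨′ ψ) σ ts τ e = ⇔-trans (accepts-∨ (automaton φ) (automaton ψ) _) (mk⇔
  (λ { (inj₁ h) → inj₁ (to (automaton-correct φ σ ts τ e) h) ; (inj₂ k) → inj₂ (to (automaton-correct ψ σ ts τ e) k) })
  (λ { (inj₁ h) → inj₁ (from (automaton-correct φ σ ts τ e) h) ; (inj₂ k) → inj₂ (from (automaton-correct ψ σ ts τ e) k) }))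
automaton-correct (∃¹ φ) σ ts τ e = ⇔-trans (accepts-exists₁ (automaton φ) σ ts) (mk⇔
  (λ (u , h) → u , to (automaton-correct φ (extend u σ) ts τ e) h)
  (λ (u , h) → u , from (automaton-correct φ (extend u σ) ts τ e) h))
automaton-correct (∀¹ φ) σ ts τ e =
  ⇔-trans (accepts-complement (exists₁ (complement (automaton φ))) _)
  (⇔-trans (¬-cong (⇔-trans (accepts-exists₁ (complement (automaton φ)) σ ts) (mk⇔
    (λ (u , h) → u , to (accepts-complement (automaton φ) _) h) (λ (u , h) → u , from (accepts-complement (automaton φ) _) h))))
  (⇔-trans (∀⇔¬∃¬ (λ u → accepts? (automaton φ) (environment (extend u σ) ts)))
  (mk⇔ (λ h u → to (automaton-correct φ (extend u σ) ts τ e) (h u)) (λ h u → from (automaton-correct φ (extend u σ) ts τ e) (h u)))))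
automaton-correct (∃ˢ φ) σ ts τ e = ⇔-trans (accepts-existsₛ (automaton φ) σ ts) (mk⇔
  (λ (U , h) → fromFS U , to (automaton-correct φ σ (extend U ts) (extend (fromFS U) τ)
    λ { zero → ≋-sym (toFS-fromFS U) ; (suc i) → e i }) h)
  (λ (U , h) → toFS U , from (automaton-correct φ σ (extend (toFS U) ts) (extend U τ) λ { zero → ≋-refl ; (suc i) → e i }) h))
automaton-correct (∀ˢ φ) σ ts τ e =
  ⇔-trans (accepts-complement (existsₛ (complement (automaton φ))) _)
  (⇔-trans (¬-cong (⇔-trans (accepts-existsₛ (complement (automaton φ)) σ ts) (mk⇔
    (λ (U , h) → U , to (accepts-complement (automaton φ) _) h) (λ (U , h) → U , from (accepts-complement (automaton φ) _) h))))
  (⇔-trans (∀⇔¬∃¬ (λ U → accepts? (automaton φ) (environment σ (extend U ts)))) (mk⇔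
    (λ h U → to (automaton-correct φ σ (extend (toFS U) ts) (extend U τ) λ { zero → ≋-refl ; (suc i) → e i }) (h (toFS U)))
    (λ h U → from (automaton-correct φ σ (extend U ts) (extend (fromFS U) τ)
      λ { zero → ≋-sym (toFS-fromFS U) ; (suc i) → e i }) (h (fromFS U))))))

module _ {k : ℕ} (φ : Form 0 k) where

  recogniser : Automaton (replicate k false)
  recogniser = relabel (automaton φ) (replicate k false) ([] ,_) refl

  accepts-recogniser : ∀ (ts : Fin k → FS) τ → (∀ i → ts i ≋ toFS (τ i)) → Accepts recogniser (tracks ts) ⇔ (φ ⊨ τ)
  accepts-recogniser ts τ e rewrite state-relabel (automaton φ) ([] ,_) refl {tracks ts} {environment noVars ts} (λ _ → refl) =
    automaton-correct φ noVars ts τ e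

  recogniser-correct : ∀ τ → Accepts recogniser (tracks (toFS ∘ τ)) ⇔ (φ ⊨ τ)
  recogniser-correct τ = accepts-recogniser (toFS ∘ τ) τ (λ _ → ≋-refl)

  -- Decidability of WMSO over the binary tree. It is what permits classical connectives in
  -- definability proofs and, at the end, the search for an automaton.
  ⊨? : ∀ τ → Dec (φ ⊨ τ)
  ⊨? τ = map⇔ (recogniser-correct τ) (accepts? recogniser _)

  ⊨-cong : ∀ {τ τ′} → (∀ i → τ i ≈ˢ τ′ i) → φ ⊨ τ → φ ⊨ τ′
  ⊨-cong {τ} {τ′} e h = to (recogniser-correct τ′)
    (accepts-cong recogniser (tracks-cong (λ i → toFS-cong (e i))) (from (recogniser-correct τ) h))

-- Definability in a presentation

renameForm : ∀ {m n n′} → (Fin n → Fin n′) → Form m n → Form m n′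
liftVar : ∀ {n n′} → (Fin n → Fin n′) → Fin (suc n) → Fin (suc n′)
liftVar θ = extend zero (suc ∘ θ)
renameForm θ (x ∈′ X) = x ∈′ θ X
renameForm θ (x ≐ y)  = x ≐ y
renameForm θ (S₀ x y) = S₀ x y
renameForm θ (S₁ x y) = S₁ x y
renameForm θ (¬′ φ)   = ¬′ renameForm θ φ
renameForm θ (φ ∧′ ψ) = renameForm θ φ ∧′ renameForm θ ψ
renameForm θ (φ ∨′ ψ) = renameForm θ φ ∨′ renameForm θ ψ
renameForm θ (∃¹ φ)   = ∃¹ (renameForm θ φ)
renameForm θ (∀¹ φ)   = ∀¹ (renameForm θ φ)
renameForm θ (∃ˢ φ)   = ∃ˢ (renameForm (liftVar θ) φ)
renameForm θ (∀ˢ φ)   = ∀ˢ (renameForm (liftVar θ) φ)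

Sat-rename : ∀ {m n n′} (θ : Fin n → Fin n′) (φ : Form m n) σ {τ τ′} → (∀ i → τ i ≡ τ′ (θ i))
  → Sat φ σ τ ⇔ Sat (renameForm θ φ) σ τ′
Sat-rename θ (x ∈′ X) σ e rewrite e X = mk⇔ id id
Sat-rename θ (x ≐ y)  σ e = mk⇔ id id
Sat-rename θ (S₀ x y) σ e = mk⇔ id id
Sat-rename θ (S₁ x y) σ e = mk⇔ id id
Sat-rename θ (¬′ φ)   σ e = ¬-cong (Sat-rename θ φ σ e)
Sat-rename θ (φ ∧′ ψ) σ e = mk⇔
  (λ (h , k) → to (Sat-rename θ φ σ e) h , to (Sat-rename θ ψ σ e) k)
  (λ (h , k) → from (Sat-rename θ φ σ e) h , from (Sat-rename θ ψ σ e) k)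
Sat-rename θ (φ ∨′ ψ) σ e = mk⇔
  (λ { (inj₁ h) → inj₁ (to (Sat-rename θ φ σ e) h) ; (inj₂ k) → inj₂ (to (Sat-rename θ ψ σ e) k) })
  (λ { (inj₁ h) → inj₁ (from (Sat-rename θ φ σ e) h) ; (inj₂ k) → inj₂ (from (Sat-rename θ ψ σ e) k) })
Sat-rename θ (∃¹ φ)   σ e = mk⇔
  (λ (u , h) → u , to (Sat-rename θ φ (extend u σ) e) h) (λ (u , h) → u , from (Sat-rename θ φ (extend u σ) e) h)
Sat-rename θ (∀¹ φ)   σ e = mk⇔
  (λ h u → to (Sat-rename θ φ (extend u σ) e) (h u)) (λ h u → from (Sat-rename θ φ (extend u σ) e) (h u))
Sat-rename θ (∃ˢ φ)   σ e = mk⇔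
  (λ (U , h) → U , to (Sat-rename (liftVar θ) φ σ λ { zero → refl ; (suc i) → e i }) h)
  (λ (U , h) → U , from (Sat-rename (liftVar θ) φ σ λ { zero → refl ; (suc i) → e i }) h)
Sat-rename θ (∀ˢ φ)   σ e = mk⇔
  (λ h U → to (Sat-rename (liftVar θ) φ σ λ { zero → refl ; (suc i) → e i }) (h U))
  (λ h U → from (Sat-rename (liftVar θ) φ σ λ { zero → refl ; (suc i) → e i }) (h U))

≈ˢ-refl : {A : Set} {X : FinSet A} → X ≈ˢ X
≈ˢ-refl = id , id

≈ˢ-reflexive : {A : Set} {X Y : FinSet A} → X ≡ Y → X ≈ˢ Y
≈ˢ-reflexive refl = ≈ˢ-refl

≈ˢ-sym : {A : Set} {X Y : FinSet A} → X ≈ˢ Y → Y ≈ˢ X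
≈ˢ-sym (p , q) = q , p

Env : ℕ → Set
Env k = Fin k → FinSet ℕ

-- A term of the formula language is just a coordinate of the environment. Keeping it as a function
-- of ρ lets relations be written as ordinary predicates while de Bruijn indices stay hidden.
Var : ∀ {k} → (Env k → FinSet ℕ) → Set
Var {k} t = ∃ λ (i : Fin k) → ∀ ρ → t ρ ≡ ρ i

var : ∀ {k} (i : Fin k) → Var (λ ρ → ρ i)
var i = i , λ _ → refl

wk : ∀ {k} {t : Env k → FinSet ℕ} → Var t → Var {suc k} (λ ρ → t (ρ ∘ suc))
wk (i , e) = suc i , λ ρ → e (ρ ∘ suc)

module Definability (p : Presentation) where
  open Presentation p

  Def : ∀ {k} → (Env k → Set) → Set
  Def = DefinableIn p

  def-cong : ∀ {k} {P : Env k → Set} → Def P → ∀ {us vs} → (∀ i → us i ≈ˢ vs i) → P us → P vs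
  def-cong (φ , d) e h = from (d _) (⊨-cong φ (λ i → f-resp _ _ (e i)) (to (d _) h))

  def? : ∀ {k} {P : Env k → Set} → Def P → ∀ us → Dec (P us)
  def? (φ , d) us = map⇔ (⇔-sym (d us)) (⊨? φ (f ∘ us))

  def-⇔ : ∀ {k} {P Q : Env k → Set} → (∀ us → P us ⇔ Q us) → Def P → Def Q
  def-⇔ e (φ , d) = φ , λ us → ⇔-trans (⇔-sym (e us)) (d us)

  def-⊤ : ∀ {k} → Def {k} (λ _ → ⊤)
  def-⊤ = ∀¹ (zero ≐ zero) , λ _ → mk⇔ (λ _ _ → refl) (λ _ → tt)

  module _ {k} {P : Env k → Set} (dP : Def P) where

    def-¬ : Def (λ ρ → ¬ P ρ)
    def-¬ = ¬′ proj₁ dP , λ us → ¬-cong (proj₂ dP us)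

    module _ {Q : Env k → Set} (dQ : Def Q) where

      def-× : Def (λ ρ → P ρ × Q ρ)
      def-× = proj₁ dP ∧′ proj₁ dQ , λ us → mk⇔
        (λ (h , h′) → to (proj₂ dP us) h , to (proj₂ dQ us) h′)
        (λ (h , h′) → from (proj₂ dP us) h , from (proj₂ dQ us) h′)

      def-⊎ : Def (λ ρ → P ρ ⊎ Q ρ)
      def-⊎ = proj₁ dP ∨′ proj₁ dQ , λ us → mk⇔
        (λ { (inj₁ h) → inj₁ (to (proj₂ dP us) h) ; (inj₂ h) → inj₂ (to (proj₂ dQ us) h) })
        (λ { (inj₁ h) → inj₁ (from (proj₂ dP us) h) ; (inj₂ h) → inj₂ (from (proj₂ dQ us) h) })

  def-→ : ∀ {k} {P Q : Env k → Set} → Def P → Def Q → Def (λ ρ → P ρ → Q ρ)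
  def-→ dP dQ = def-⇔ (λ us → mk⇔
    (λ { (inj₁ n) h → contradiction h n ; (inj₂ q) _ → q }) (λ g → helper (def? dP us) g)) (def-⊎ (def-¬ dP) dQ)
    where
    helper : {A B : Set} → Dec A → (A → B) → ¬ A ⊎ B
    helper (yes a) g = inj₂ (g a)
    helper (no n)  g = inj₁ n

  def-const : ∀ {k} {A : Set} → Dec A → Def {k} (λ _ → A)
  def-const (yes a) = def-⇔ (λ _ → mk⇔ (λ _ → a) (λ _ → tt)) def-⊤
  def-const (no n)  = def-⇔ (λ _ → mk⇔ (λ h → ⊥-elim (h tt)) (λ a → ⊥-elim (n a))) (def-¬ def-⊤)

  def-∀ᶠ : ∀ {k} n {P : Fin n → Env k → Set} → (∀ d → Def (P d)) → Def (λ ρ → ∀ d → P d ρ)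
  def-∀ᶠ zero    dP = def-⇔ (λ _ → mk⇔ (λ _ ()) (λ _ → tt)) def-⊤
  def-∀ᶠ (suc n) dP = def-⇔ (λ _ → mk⇔ (λ { (h , hs) zero → h ; (h , hs) (suc d) → hs d }) (λ h → h zero , h ∘ suc))
    (def-× (dP zero) (def-∀ᶠ n (dP ∘ suc)))

  def-∃ᶠ : ∀ {k} n {P : Fin n → Env k → Set} → (∀ d → Def (P d)) → Def (λ ρ → ∃ λ d → P d ρ)
  def-∃ᶠ zero    dP = def-⇔ (λ _ → mk⇔ (λ h → ⊥-elim (h tt)) (λ ())) (def-¬ def-⊤)
  def-∃ᶠ (suc n) dP = def-⇔ (λ _ → mk⇔ (λ { (inj₁ h) → zero , h ; (inj₂ (d , h)) → suc d , h })
    (λ { (zero , h) → inj₁ h ; (suc d , h) → inj₂ (d , h) })) (def-⊎ (dP zero) (def-∃ᶠ n (dP ∘ suc)))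

  private
    atom : ∀ {k} {s t : Env k → FinSet ℕ} (φ : Form 0 2) → Var s → Var t → ∃ λ (ψ : Form 0 k) →
      ∀ ρ → (φ ⊨ pair (f (s ρ)) (f (t ρ))) ⇔ (ψ ⊨ (f ∘ ρ))
    atom φ (i , e) (j , e′) = renameForm (pair i j) φ , λ ρ →
      Sat-rename (pair i j) φ noVars λ { zero → cong f (e ρ) ; (suc zero) → cong f (e′ ρ) }

  module _ {k} {s t : Env k → FinSet ℕ} (vs : Var s) (vt : Var t) where

    def-⊆ : Def (λ ρ → s ρ ⊆ t ρ)
    def-⊆ = let ψ , h = atom (proj₁ ⪯-def) vs vt in ψ , λ ρ → ⇔-trans (proj₂ ⪯-def (s ρ) (t ρ)) (h ρ)

    def-succ : Def (λ ρ → SuccW (s ρ) (t ρ))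
    def-succ = let ψ , h = atom (proj₁ succ-def) vs vt in ψ , λ ρ → ⇔-trans (proj₂ succ-def (s ρ) (t ρ)) (h ρ)

  def-subst : ∀ {k l} {P : Env k → Set} → Def P → (Qs : Env l → Env k) → (∀ d → Var (λ ρ → Qs ρ d)) → Def (λ ρ → P (Qs ρ))
  def-subst (φ , d) Qs vQs = renameForm (proj₁ ∘ vQs) φ , λ ρ →
    ⇔-trans (d (Qs ρ)) (Sat-rename (proj₁ ∘ vQs) φ noVars (λ i → cong f (proj₂ (vQs i) ρ)))

  domAt : ∀ {k} (i : Fin k) → ∃ λ (ψ : Form 0 k) → ∀ τ → (ψ ⊨ τ) ⇔ (∃ λ X → f X ≈ˢ τ i)
  domAt i = renameForm (single i) (proj₁ dom) , λ τ →
    ⇔-trans (⇔-sym (Sat-rename (single i) (proj₁ dom) noVars λ { zero → refl })) (proj₂ dom (τ i))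

  module _ {k} {P : Env (suc k) → Set} (dP : Def P) where

    private
      φ = proj₁ dP

      extend-f : ∀ {X U} {ρ : Env k} → f X ≈ˢ U → ∀ i → f (extend X ρ i) ≈ˢ extend U (f ∘ ρ) i
      extend-f e zero    = e
      extend-f e (suc i) = ≈ˢ-refl

      instantiate : ∀ {X U} {ρ : Env k} → f X ≈ˢ U → P (extend X ρ) ⇔ (φ ⊨ extend U (f ∘ ρ))
      instantiate {X} {U} {ρ} e = ⇔-trans (proj₂ dP (extend X ρ))
        (mk⇔ (⊨-cong φ (extend-f e)) (⊨-cong φ (λ i → ≈ˢ-sym (extend-f e i))))

    -- The quantifier of a formula ranges over all finite sets of words; `dom` relativises it to
    -- codes.
    def-∃ : Def (λ ρ → ∃ λ X → P (extend X ρ))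
    def-∃ = ∃ˢ (proj₁ (domAt zero) ∧′ φ) , λ ρ → mk⇔
      (λ (X , h) → f X , from (proj₂ (domAt zero) _) (X , ≈ˢ-refl) , to (instantiate ≈ˢ-refl) h)
      (λ (U , d , h) → let X , e = to (proj₂ (domAt zero) _) d in X , from (instantiate e) h)

    def-∀ : Def (λ ρ → ∀ X → P (extend X ρ))
    def-∀ = ∀ˢ ((¬′ proj₁ (domAt zero)) ∨′ φ) , λ ρ → mk⇔ (there′ ρ) (back ρ)
      where
      there′ : ∀ ρ → (∀ X → P (extend X ρ)) → ∀ U →
        ¬ (proj₁ (domAt zero) ⊨ extend U (f ∘ ρ)) ⊎ (φ ⊨ extend U (f ∘ ρ))
      there′ ρ h U with ⊨? (proj₁ (domAt zero)) (extend U (f ∘ ρ))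
      ... | no n  = inj₁ n
      ... | yes d = let X , e = to (proj₂ (domAt zero) _) d in inj₂ (to (instantiate e) (h X))
      back : ∀ ρ → (∀ U → ¬ (proj₁ (domAt zero) ⊨ extend U (f ∘ ρ)) ⊎ (φ ⊨ extend U (f ∘ ρ))) → ∀ X → P (extend X ρ)
      back ρ h X with h (f X)
      ... | inj₁ n = ⊥-elim (n (from (proj₂ (domAt zero) _) (X , ≈ˢ-refl)))
      ... | inj₂ k = from (instantiate ≈ˢ-refl) k

  module _ {k} {P : Env (suc k) → Set} (dP : Def P) where

    private
      -- Every number has a successor, so the singletons are exactly the sets that occur on the left
      -- of `SuccW`.
      isNumber : Def {suc k} (λ ρ → ∃ λ Y → SuccW (ρ zero) Y)
      isNumber = def-∃ (def-succ (var (suc zero)) (var zero))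

      single-cong : ∀ {X i} {ρ : Env k} → X ≈ˢ [ i ] → ∀ j → extend X ρ j ≈ˢ extend [ i ] ρ j
      single-cong e zero    = e
      single-cong e (suc j) = ≈ˢ-refl

    def-∀ℕ : Def (λ ρ → ∀ i → P (extend [ i ] ρ))
    def-∀ℕ = def-⇔ (λ ρ → mk⇔
      (λ h i → h [ i ] ([ suc i ] , i , ≈ˢ-refl , ≈ˢ-refl))
      (λ h X (Y , i , e , _) → def-cong dP (λ j → ≈ˢ-sym (single-cong e j)) (h i)))
      (def-∀ (def-→ isNumber dP))

    def-∃ℕ : Def (λ ρ → ∃ λ i → P (extend [ i ] ρ))
    def-∃ℕ = def-⇔ (λ ρ → mk⇔
      (λ { (X , (Y , i , e , _) , h) → i , def-cong dP (single-cong e) h })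
      (λ (i , h) → [ i ] , ([ suc i ] , i , ≈ˢ-refl , ≈ˢ-refl) , h))
      (def-∃ (def-× isNumber dP))

  opaque
    code : FinSet ℕ → FS
    code X = toFS (f X)

    code-cong : ∀ {X Y} → X ≈ˢ Y → code X ≋ code Y
    code-cong e = toFS-cong (f-resp _ _ e)

    code-injective : ∀ {X Y} → code X ≋ code Y → X ≈ˢ Y
    code-injective e = f-inj _ _ (toFS-injective e)

  module _ {k} {P : Env k → Set} (dP : Def P) where

    private
      conj : ∀ n → (Fin n → Form 0 k) → Form 0 k
      conj zero    φ = ∀¹ (zero ≐ zero)
      conj (suc n) φ = φ zero ∧′ conj n (φ ∘ suc)

      ⊨-conj : ∀ n (φ : Fin n → Form 0 k) τ → (conj n φ ⊨ τ) ⇔ (∀ i → φ i ⊨ τ)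
      ⊨-conj zero    φ τ = mk⇔ (λ _ ()) (λ _ _ → refl)
      ⊨-conj (suc n) φ τ = mk⇔ (λ { (h , hs) zero → h ; (h , hs) (suc i) → to (⊨-conj n (φ ∘ suc) τ) hs i })
        (λ h → h zero , from (⊨-conj n (φ ∘ suc) τ) (h ∘ suc))

      onCodes : Form 0 k
      onCodes = conj k (λ i → proj₁ (domAt i)) ∧′ proj₁ dP

    opaque
      unfolding code

      codesOf : Automaton (replicate k false)
      codesOf = recogniser onCodes

      -- Because `onCodes` also tests that every track is a code, acceptance of an arbitrary tuple
      -- of trees, such as a pumped or grafted one, leads back to elements of the presented
      -- structure.
      accepts-codesOf : ∀ ts → Accepts codesOf (tracks ts) ⇔ (∃ λ us → (∀ i → code (us i) ≋ ts i) × P us)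
      accepts-codesOf ts = ⇔-trans (accepts-recogniser onCodes ts (fromFS ∘ ts) (λ i → ≋-sym (toFS-fromFS (ts i)))) (mk⇔
        (λ (d , h) → let c = λ i → to (proj₂ (domAt i) _) (to (⊨-conj k _ _) d i) in
          (λ i → proj₁ (c i)) , (λ i → ≋-trans (toFS-cong (proj₂ (c i))) (toFS-fromFS (ts i))) ,
          from (proj₂ dP _) (⊨-cong (proj₁ dP) (λ i → ≈ˢ-sym (proj₂ (c i))) h))
        (λ (us , e , h) → let e′ = λ i → toFS-injective (≋-trans (e i) (≋-sym (toFS-fromFS (ts i)))) in
          from (⊨-conj k _ _) (λ i → from (proj₂ (domAt i) _) (us i , e′ i)) ,
          ⊨-cong (proj₁ dP) e′ (to (proj₂ dP us) h)))

    accepts-codes : ∀ us → Accepts codesOf (tracks (code ∘ us)) ⇔ P us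
    accepts-codes us = ⇔-trans (accepts-codesOf (code ∘ us)) (mk⇔
      (λ (vs , e , h) → def-cong dP (λ i → code-injective (e i)) h) (λ h → us , (λ _ → ≋-refl) , h))

-- Finite automata reading a tuple of sets of numbers, position by position

infix 4 _∈ℕ?_
_∈ℕ?_ : (i : ℕ) (X : FinSet ℕ) → Dec (i ∈ X)
i ∈ℕ? X = any?ᴸ (i ℕₚ.≟_) X

singleton⊆ : {i : ℕ} {X : FinSet ℕ} → ([ i ] ⊆ X) ⇔ (i ∈ X)
singleton⊆ = mk⇔ (λ h → h (here refl)) (λ h → λ { (here refl) → h })

singleton-injective : {i j : ℕ} → [ i ] ≈ˢ [ j ] → i ≡ j
singleton-injective (p , _) with p (here refl)
... | here e = e

succ-singletons : ∀ {i j} → SuccW [ i ] [ j ] ⇔ (j ≡ suc i)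
succ-singletons = mk⇔
  (λ (a , e , e′) → trans (singleton-injective e′) (cong suc (sym (singleton-injective e))))
  (λ { refl → _ , ≈ˢ-refl , ≈ˢ-refl })

bound : FinSet ℕ → ℕ
bound []      = 0
bound (i ∷ X) = suc i ⊔ bound X

∈⇒<bound : ∀ {i X} → i ∈ X → i < bound X
∈⇒<bound {X = j ∷ X} (here refl) = ℕₚ.m≤m⊔n _ (bound X)
∈⇒<bound {X = j ∷ X} (there h)   = ℕₚ.≤-trans (∈⇒<bound h) (ℕₚ.m≤n⊔m (suc j) _)

-- Among the finite sets, the initial segments of ℕ.
PredClosed : FinSet ℕ → Set
PredClosed S = ∀ i j → SuccW [ i ] [ j ] → [ j ] ⊆ S → [ i ] ⊆ S

predClosed-downward : ∀ {S} → PredClosed S → ∀ {i j} → i ≤ j → j ∈ S → i ∈ S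
predClosed-downward c {i} i≤j h = go (ℕₚ.≤⇒≤′ i≤j) h
  where
  go : ∀ {j} → i ℕ.≤′ j → j ∈ _ → i ∈ _
  go ℕ.≤′-refl     h = h
  go (ℕ.≤′-step l) h = go l (to singleton⊆ (c _ _ (from succ-singletons refl) (from singleton⊆ h)))

predClosed-upTo : ∀ n → PredClosed (upTo n)
predClosed-upTo n i j s h with to succ-singletons s
... | refl = from singleton⊆ (∈ₚ.∈-upTo⁺ (ℕₚ.<-trans (ℕₚ.n<1+n i) (∈ₚ.∈-upTo⁻ (to singleton⊆ h))))

-- The length is the least number missing from S. The search ends because `bound S` is not a member.
predClosed-segment : ∀ {S} → PredClosed S → ∃ λ n → ∀ i → (i ∈ S) ⇔ (i < n)
predClosed-segment {S} c = let n , n∉S , below = search in n , λ i →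
  mk⇔ (λ h → ℕₚ.≰⇒> λ n≤i → n∉S (predClosed-downward c n≤i h)) below
  where
  segment : ∀ m → (∃ λ n → n ∉ S × (∀ {i} → i < n → i ∈ S)) ⊎ (∀ {i} → i < m → i ∈ S)
  segment zero    = inj₂ λ ()
  segment (suc m) with segment m
  ... | inj₁ r = inj₁ r
  ... | inj₂ a with m ∈ℕ? S
  ...   | no m∉S  = inj₁ (m , m∉S , a)
  ...   | yes m∈S = inj₂ λ i<1+m → predClosed-downward c (ℕₚ.≤-pred i<1+m) m∈S
  search : ∃ λ n → n ∉ S × (∀ {i} → i < n → i ∈ S)
  search with segment (suc (bound S))
  ... | inj₁ r = r
  ... | inj₂ a = ⊥-elim (ℕₚ.<-irrefl refl (∈⇒<bound (a (ℕₚ.n<1+n (bound S)))))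

-- A formula binds one set at a time, so the quantifier over K-tuples is unrolled. Without function
-- extensionality a given tuple is met only up to pointwise equality, hence the `Qs′` in
-- `allSets-elim`.
AllSets : ∀ K → (Env K → Set) → Set
AllSets zero    P = P noVars
AllSets (suc K) P = ∀ X → AllSets K (λ Qs → P (extend X Qs))

allSets-intro : ∀ K {P : Env K → Set} → (∀ Qs → P Qs) → AllSets K P
allSets-intro zero    h = h _
allSets-intro (suc K) h = λ X → allSets-intro K (λ Qs → h (extend X Qs))

allSets-elim : ∀ K {P : Env K → Set} → AllSets K P → ∀ (Qs : Env K) → ∃ λ (Qs′ : Env K) → (∀ d → Qs′ d ≡ Qs d) × P Qs′
allSets-elim zero    h Qs = _ , (λ ()) , h
allSets-elim (suc K) h Qs = let Qs′ , e , h′ = allSets-elim K (h (Qs zero)) (Qs ∘ suc) in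
  extend (Qs zero) Qs′ , (λ { zero → refl ; (suc d) → e d }) , h′

subset-member : ∀ {m} (s : Fin (2 ^ m)) → subset (member {m} s) ≡ s
subset-member {m} s = trans (funToFin-cong (λ q → bit-unbit (finToFun {2} {m} s q))) (Finₚ.funToFin-finToFin {m} s)
  where
  bit-unbit : ∀ b → bit (unbit b) ≡ b
  bit-unbit zero       = refl
  bit-unbit (suc zero) = refl

letterAt : ∀ {r} → Env r → ℕ → Fin (2 ^ r)
letterAt Xs i = subset (λ k → does (i ∈ℕ? Xs k))

module DFA {r K : ℕ} (δᴰ : Fin K → Fin (2 ^ r) → Fin K) (final : Fin K → Bool) (q₀ : Fin K) where

  run : Env r → ℕ → Fin K
  run Xs zero    = q₀
  run Xs (suc i) = δᴰ (run Xs i) (letterAt Xs i)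

  -- Reading may stop at any common upper bound of the sets.
  Accepted : Env r → Set
  Accepted Xs = ∃ λ n → (∀ k {i} → i ∈ Xs k → i < n) × final (run Xs n) ≡ true

  Matches : Bool → Set → Set
  Matches true  A = A
  Matches false A = ¬ A

  IsLetter : FinSet ℕ → Env r → Fin (2 ^ r) → Set
  IsLetter I Xs a = ∀ k → Matches (member {r} a k) (I ⊆ Xs k)

  matches-does : ∀ {A : Set} (d : Dec A) b → Matches b A ⇔ (does d ≡ b)
  matches-does (yes a) true  = mk⇔ (λ _ → refl) (λ _ → a)
  matches-does (yes a) false = mk⇔ (λ n → ⊥-elim (n a)) λ ()
  matches-does (no n)  true  = mk⇔ (λ a → ⊥-elim (n a)) λ ()
  matches-does (no n)  false = mk⇔ (λ _ → refl) (λ _ → n)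

  isLetter-correct : ∀ i Xs a → IsLetter [ i ] Xs a ⇔ (letterAt Xs i ≡ a)
  isLetter-correct i Xs a = mk⇔
    (λ h → trans (subset-cong (λ k → to (matches-does (i ∈ℕ? Xs k) (member {r} a k)) (matches-cong (member {r} a k) (singleton⊆ {i} {Xs k}) (h k))))
      (subset-member {r} a))
    (λ { refl k → matches-cong (member {r} a k) (⇔-sym (singleton⊆ {i} {Xs k})) (from (matches-does (i ∈ℕ? Xs k) (member {r} a k))
      (sym (member-subset (λ k → does (i ∈ℕ? Xs k)) k))) })
    where
    matches-cong : ∀ b {A B : Set} → A ⇔ B → Matches b A → Matches b B
    matches-cong true  e = to e
    matches-cong false e = to (¬-cong e)

  -- Zero is described as the number without a predecessor.
  Initial : Env K → Set
  Initial Qs = ∀ z → (∀ y → ¬ SuccW [ y ] [ z ]) → [ z ] ⊆ Qs q₀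

  Step : FinSet ℕ → Env r → Env K → Set
  Step S Xs Qs = ∀ i j → SuccW [ i ] [ j ] → [ i ] ⊆ S → ∀ d a → IsLetter [ i ] Xs a → [ i ] ⊆ Qs d → [ j ] ⊆ Qs (δᴰ d a)

  Final : FinSet ℕ → Env K → Set
  Final S Qs = ∃ λ j → ¬ ([ j ] ⊆ S) × ∃ λ d → (final d ≡ true) × ([ j ] ⊆ Qs d)

  -- The sets Qs d need only contain the positions reached in state d.
  Described : Env r → Set
  Described Xs = ∃ λ S → PredClosed S × (∀ k → Xs k ⊆ S) × AllSets K (λ Qs → Initial Qs → Step S Xs Qs → Final S Qs)

  described⇔accepted : ∀ Xs → Described Xs ⇔ Accepted Xs
  described⇔accepted Xs = mk⇔ there′ back
    where
    there′ : Described Xs → Accepted Xs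
    there′ (S , c , X⊆S , all) with predClosed-segment c
    -- The universal statement is applied to the exact positions of the run. They go up to n
    -- inclusive, since the state after the last letter sits at n, just outside S; `Final` can then
    -- be met only at j = n.
    ... | n , seg with allSets-elim K all (λ d → filter (λ i → run Xs i Finₚ.≟ d) (upTo (suc n)))
    ... | Qs , Qs≡ , h = n , (λ k i∈X → to (seg _) (X⊆S k i∈X)) , conclude (h initial step)
      where
      enter : ∀ {i} → i ≤ n → i ∈ Qs (run Xs i)
      enter {i} i≤n rewrite Qs≡ (run Xs i) = ∈ₚ.∈-filter⁺ (λ j → run Xs j Finₚ.≟ run Xs i) (∈ₚ.∈-upTo⁺ (s≤s i≤n)) refl
      exit : ∀ {i d} → i ∈ Qs d → i ≤ n × run Xs i ≡ d
      exit {i} {d} h rewrite Qs≡ d = let h₁ , h₂ = ∈ₚ.∈-filter⁻ (λ j → run Xs j Finₚ.≟ d) {xs = upTo (suc n)} h in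
        ℕₚ.≤-pred (∈ₚ.∈-upTo⁻ h₁) , h₂
      initial : Initial Qs
      initial zero    _ = from singleton⊆ (enter z≤n)
      initial (suc z) h = ⊥-elim (h z (from succ-singletons refl))
      step : Step S Xs Qs
      step i j s i∈S d a ℓ i∈d with to succ-singletons s | to (isLetter-correct i Xs a) ℓ | exit (to singleton⊆ i∈d)
      ... | refl | refl | _ , refl = from singleton⊆ (enter (to (seg i) (to singleton⊆ i∈S)))
      conclude : Final S Qs → final (run Xs n) ≡ true
      conclude (j , j∉S , d , fd , j∈d) with exit (to singleton⊆ j∈d)
      ... | j≤n , refl with ℕₚ.≤-antisym j≤n (ℕₚ.≮⇒≥ (λ j<n → j∉S (from singleton⊆ (from (seg j) j<n))))
      ... | refl = fd
    back : Accepted Xs → Described Xs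
    back (n , X<n , fin) = upTo n , predClosed-upTo n , (λ k h → ∈ₚ.∈-upTo⁺ (X<n k h)) ,
      allSets-intro K conclude
      where
      case₀ : {y : ℕ} → 0 ≡ suc y → ⊥
      case₀ ()
      reach : ∀ Qs → Initial Qs → Step (upTo n) Xs Qs → ∀ i → i ≤ n → [ i ] ⊆ Qs (run Xs i)
      reach Qs initial step zero    _   = initial zero (λ y h → case₀ (to succ-singletons h))
      reach Qs initial step (suc i) i<n = step i (suc i) (from succ-singletons refl) (from singleton⊆ (∈ₚ.∈-upTo⁺ i<n))
        (run Xs i) (letterAt Xs i) (from (isLetter-correct i Xs _) refl) (reach Qs initial step i (ℕₚ.<⇒≤ i<n))
      conclude : ∀ Qs → Initial Qs → Step (upTo n) Xs Qs → Final (upTo n) Qs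
      conclude Qs initial step = n , n∉ , run Xs n , fin , reach Qs initial step n ℕₚ.≤-refl
        where
        n∉ : ¬ ([ n ] ⊆ upTo n)
        n∉ h = ℕₚ.<-irrefl refl (∈ₚ.∈-upTo⁻ (h (here refl)))

-- Definability of the order and of finite automata in any presentation

module DefinableRelations (p : Presentation) where
  open Definability p

  -- The number of binders is a variable, so the body passes through the induction abstractly: it
  -- must be definable for every choice of the coordinates that `π` and `Qs` select.
  def-AllSets : ∀ K {k} (P : Env k → Env K → Set)
    → (∀ {l} (π : Env l → Env k) → (∀ i → Var (λ ρ → π ρ i)) → (Qs : Env l → Env K) → (∀ d → Var (λ ρ → Qs ρ d))
       → Def (λ ρ → P (π ρ) (Qs ρ)))
    → Def (λ ρ → AllSets K (P ρ))
  def-AllSets zero    P body = body id var (λ _ → noVars) λ ()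
  def-AllSets (suc K) P body = def-∀ (def-AllSets K (λ ρ Qs → P (ρ ∘ suc) (extend (ρ zero) Qs))
    λ π vπ Qs vQs → body (λ ρ → π ρ ∘ suc) (vπ ∘ suc) (λ ρ → extend (π ρ zero) (Qs ρ)) λ { zero → vπ zero ; (suc d) → vQs d })

  def-PredClosed : ∀ {k} {S : Env k → FinSet ℕ} → Var S → Def (λ ρ → PredClosed (S ρ))
  def-PredClosed vS = def-∀ℕ (def-∀ℕ (def-→ (def-succ (var (suc zero)) (var zero))
    (def-→ (def-⊆ (var zero) (wk (wk vS))) (def-⊆ (var (suc zero)) (wk (wk vS))))))

  IsNumber : FinSet ℕ → Set
  IsNumber X = ∃ λ i → X ≈ˢ [ i ]

  def-IsNumber : ∀ {k} {X : Env k → FinSet ℕ} → Var X → Def (λ ρ → IsNumber (X ρ))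
  def-IsNumber vX = def-⇔ (λ ρ → mk⇔ (λ (_ , i , e , _) → i , e) (λ (i , e) → [ suc i ] , i , e , ≈ˢ-refl))
    (def-∃ (def-succ (wk vX) (var zero)))

  LessEq : FinSet ℕ → FinSet ℕ → Set
  LessEq X Y = ∃₂ λ i j → X ≈ˢ [ i ] × Y ≈ˢ [ j ] × i ≤ j

  -- The order is second-order over successor: i ≤ j iff every initial segment containing j contains
  -- i. The segment ending at j is the decisive instance.
  def-LessEq : ∀ {k} {X Y : Env k → FinSet ℕ} → Var X → Var Y → Def (λ ρ → LessEq (X ρ) (Y ρ))
  def-LessEq vX vY = def-⇔ (λ ρ → mk⇔
      (λ { ((i , e) , (j , e′) , h) → i , j , e , e′ ,
           ℕₚ.≤-pred (∈ₚ.∈-upTo⁻ (h (upTo (suc j)) (predClosed-upTo (suc j))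
             (λ k → ⊆-singleton (proj₁ e′ k) (∈ₚ.∈-upTo⁺ (ℕₚ.n<1+n j))) (proj₂ e (here refl)))) })
      (λ { (i , j , e , e′ , i≤j) → (i , e) , (j , e′) , λ S c h k → ⊆-singleton (proj₁ e k)
           (predClosed-downward c i≤j (h (proj₂ e′ (here refl)))) }))
    (def-× (def-IsNumber vX) (def-× (def-IsNumber vY)
      (def-∀ (def-→ (def-PredClosed (var zero)) (def-→ (def-⊆ (wk vY) (var zero)) (def-⊆ (wk vX) (var zero)))))))
    where
    ⊆-singleton : ∀ {i j : ℕ} {S} → i ∈ [ j ] → j ∈ S → i ∈ S
    ⊆-singleton (here refl) h = h

  module _ {r K : ℕ} (δᴰ : Fin K → Fin (2 ^ r) → Fin K) (final : Fin K → Bool) (q₀ : Fin K) where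
    open DFA {r} {K} δᴰ final q₀

    private
      def-Matches : ∀ {k} b {P : Env k → Set} → Def P → Def (λ ρ → Matches b (P ρ))
      def-Matches true  d = d
      def-Matches false d = def-¬ d

    def-Accepted : Def Accepted
    def-Accepted = def-⇔ described⇔accepted
      (def-∃ (def-× (def-PredClosed (var zero)) (def-×
        (def-∀ᶠ r (λ k → def-⊆ (var (suc k)) (var zero)))
        (def-AllSets K (λ ρ Qs → Initial Qs → Step (ρ zero) (ρ ∘ suc) Qs → Final (ρ zero) Qs)
          λ π vπ Qs vQs →
            def-→ (def-∀ℕ (def-→ (def-∀ℕ (def-¬ (def-succ (var zero) (var (suc zero))))) (def-⊆ (var zero) (wk (vQs q₀)))))
            (def-→
              (def-∀ℕ (def-∀ℕ (def-→ (def-succ (var (suc zero)) (var zero)) (def-→ (def-⊆ (var (suc zero)) (wk (wk (vπ zero))))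
                (def-∀ᶠ K λ d → def-∀ᶠ (2 ^ r) λ a →
                  def-→ (def-∀ᶠ r λ k → def-Matches (member {r} a k) (def-⊆ (var (suc zero)) (wk (wk (vπ (suc k))))))
                  (def-→ (def-⊆ (var (suc zero)) (wk (wk (vQs d)))) (def-⊆ (var zero) (wk (wk (vQs (δᴰ d a)))))))))))
              (def-∃ℕ (def-× (def-¬ (def-⊆ (var zero) (wk (vπ zero))))
                (def-∃ᶠ K λ d → def-× (def-const (final d 𝔹ₚ.≟ true)) (def-⊆ (var zero) (wk (vQs d)))))))))))

-- Pumping

within-mono : {L : Set} {z : L} {T : Tree z} {d e : ℕ} → d ≤ e → Within d T → Within e T
within-mono d≤e h w e≤w = h w (ℕₚ.≤-trans d≤e e≤w)

deepest : (T : FS) → Within 0 T ⊎ (∃ λ u → label T u ≡ true × Within (suc (length u)) T)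
deepest T = go (height T) (blank T)
  where
  go : ∀ d → Within d T → Within 0 T ⊎ (∃ λ u → label T u ≡ true × Within (suc (length u)) T)
  go zero    h = inj₁ h
  go (suc d) h with any?ᴸ (λ u → (length u ℕₚ.≟ d) ×-dec (label T u 𝔹ₚ.≟ true)) (words (suc d))
  ... | yes a with Any.satisfied a
  ...   | u , refl , e = inj₂ (u , e , h)
  go (suc d) h | no none = go d λ w d≤w → not-true λ e → case w e (ℕₚ.m≤n⇒m<n∨m≡n d≤w)
    where
    case : ∀ w → label T w ≡ true → d < length w ⊎ d ≡ length w → ⊥
    case w e (inj₁ l)    = contradiction (trans (sym e) (h w l)) λ ()
    case w e (inj₂ refl) = none (Any.map (λ { refl → refl , e }) (∈-words w (ℕₚ.n<1+n d)))

take-split : ∀ {a b} (u : Word) → a ≤ b → take b u ≡ take a u ++ take (b ∸ a) (drop a u)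
take-split u       z≤n       = refl
take-split []      (s≤s a≤b) = sym (Listₚ.take-[] _)
take-split (c ∷ u) (s≤s a≤b) = cong (c ∷_) (take-split u a≤b)

length-take-≤ : ∀ {a} (u : Word) → a ≤ length u → length (take a u) ≡ a
length-take-≤ {a} u h = trans (Listₚ.length-take a u) (ℕₚ.m≤n⇒m⊓n≡m h)

module _ (A : Automaton false) (T : FS) (u : Word) (u∈T : label T u ≡ true) (deep : Within (suc (length u)) T)
  (long : size A ≤ length u) where

  private
    -- The prefixes of lengths 0 to `size A` are one more than the states, and all of them exist by
    -- `long`.
    repeats = Finₚ.pigeonhole (ℕₚ.n<1+n (size A)) (λ i → state A (sub T (take (toℕ i) u)))
    a b : ℕ
    a = toℕ (proj₁ repeats)
    b = toℕ (proj₁ (proj₂ repeats))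
    a<b : a < b
    a<b = proj₁ (proj₂ (proj₂ repeats))
    b≤u : b ≤ length u
    b≤u = ℕₚ.≤-trans (ℕₚ.≤-pred (Finₚ.toℕ<n (proj₁ (proj₂ repeats)))) long

    x y w : Word
    x = take a u
    y = take (b ∸ a) (drop a u)
    w = y ++ drop b u

    u≡ : x ++ w ≡ u
    u≡ = trans (sym (Listₚ.++-assoc x y (drop b u)))
      (trans (cong (_++ drop b u) (sym (take-split u (ℕₚ.<⇒≤ a<b)))) (Listₚ.take++drop≡id b u))

    1≤y : 1 ≤ length y
    1≤y = ℕₚ.+-cancelˡ-≤ a 1 (length y) (subst₂ _≤_ (ℕₚ.+-comm 1 a) lengths a<b)
      where
      lengths : b ≡ a + length y
      lengths = trans (sym (length-take-≤ u b≤u)) (trans (cong length (take-split u (ℕₚ.<⇒≤ a<b)))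
        (trans (Listₚ.length-++ x) (cong (_+ length y) (length-take-≤ u (ℕₚ.≤-trans (ℕₚ.<⇒≤ a<b) b≤u)))))

    Y : FS
    Y = sub T x

    same : state A (sub Y y) ≡ state A Y
    same = trans (state-cong A (pointwise λ v → cong (label T) (sym (Listₚ.++-assoc x y v))))
      (trans (cong (λ t → state A (sub T t)) (sym (take-split u (ℕₚ.<⇒≤ a<b)))) (sym (proj₂ (proj₂ (proj₂ repeats)))))

    P : ℕ → FS
    P zero    = Y
    P (suc k) = graft Y y (P k)

    state-P : ∀ k → state A (P k) ≡ state A Y
    state-P zero    = refl
    state-P (suc k) = trans (state-graft A Y y (P k)) (trans (cong (context A y Y) (trans (state-P k) (sym same)))
      (trans (sym (state-graft A Y y (sub Y y))) (state-cong A (graft-self Y y))))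

    deepWord : ℕ → Word
    deepWord zero    = w
    deepWord (suc k) = y ++ deepWord k

    label-deepWord : ∀ k → label (P k) (deepWord k) ≡ true
    label-deepWord zero    = trans (cong (label T) u≡) u∈T
    label-deepWord (suc k) = trans (at (sub-graft Y y (P k)) (deepWord k)) (label-deepWord k)

    length-deepWord : ∀ k → length (deepWord k) ≡ k * length y + length w
    length-deepWord zero    = refl
    length-deepWord (suc k) = trans (Listₚ.length-++ y {deepWord k}) (trans (cong (length y +_) (length-deepWord k)) (sym (ℕₚ.+-assoc (length y) (k * length y) (length w))))

    within-Y : Within (suc (length w)) Y
    within-Y v h = deep (x ++ v) (subst₂ _≤_
      (trans (ℕₚ.+-suc (length x) (length w)) (cong suc (trans (sym (Listₚ.length-++ x)) (cong length u≡))))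
      (sym (Listₚ.length-++ x)) (ℕₚ.+-monoʳ-≤ (length x) h))

    within-P : ∀ k → Within (k * length y + suc (length w)) (P k)
    within-P zero    = within-Y
    within-P (suc k) v h = graftLabel-blank y (suc (length w)) (k * length y + suc (length w)) within-Y (within-P k) v
      (ℕₚ.≤-trans (ℕₚ.m≤n+m _ (length y + k * length y)) h)
      (subst (_≤ length v) (ℕₚ.+-assoc (length y) (k * length y) (suc (length w))) h)

    distinct : ∀ {k l} → k < l → ¬ P k ≋ P l
    distinct {k} {l} k<l e = contradiction (trans (sym (label-deepWord l)) (trans (sym (at e (deepWord l)))
      (within-P k (deepWord l) (subst (k * length y + suc (length w) ≤_) (sym (length-deepWord l)) longer)))) λ ()
      where
      longer : k * length y + suc (length w) ≤ l * length y + length w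
      longer = ℕₚ.≤-trans (ℕₚ.≤-reflexive (ℕₚ.+-suc (k * length y) (length w)))
        (ℕₚ.+-monoˡ-≤ (length w) (ℕₚ.≤-trans (ℕₚ.+-monoˡ-≤ (k * length y) 1≤y) (ℕₚ.*-monoˡ-≤ (length y) k<l)))

  opaque
    -- The loop y between two prefixes of u with equal states is inserted k more times. As u is a
    -- deepest node, the depth of `P k` is exactly the length of `deepWord k`; it grows with k, and
    -- this alone separates the results.
    pump : ∃ λ (F : ℕ → FS) → (∀ k → state A (F k) ≡ state A T) × (∀ {k l} → k < l → ¬ F k ≋ F l)
    pump = (λ k → graft T x (P k)) ,
      (λ k → trans (state-graft A T x (P k)) (trans (cong (context A x T) (state-P k))
        (trans (sym (state-graft A T x Y)) (state-cong A (graft-self T x))))) ,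
      (λ {k} {l} k<l e → distinct k<l (≋-trans (≋-sym (sub-graft T x (P k))) (≋-trans (sub-cong e x) (sub-graft T x (P l)))))

-- Finite searches and finite observations

smallCount : ℕ → ℕ
smallCount zero    = 1
smallCount (suc h) = 2 * (smallCount h * smallCount h)

small : ∀ h → Fin (smallCount h) → FS
smallNode : ∀ h → Fin 2 × Fin (smallCount h * smallCount h) → FS
smallNode′ : ∀ h → Fin 2 → Fin (smallCount h) × Fin (smallCount h) → FS
small zero    _ = empty
small (suc h) i = smallNode h (remQuot {2} (smallCount h * smallCount h) i)
smallNode h (b , jk) = smallNode′ h b (remQuot {smallCount h} (smallCount h) jk)
smallNode′ h b (j , k) = node (unbit b) (small h j) (small h k)

small-combine : ∀ h b j k → small (suc h) (combine b (combine j k)) ≡ node (unbit b) (small h j) (small h k)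
small-combine h b j k = trans (cong (smallNode h) (Finₚ.remQuot-combine {2} b (combine j k)))
  (cong (smallNode′ h b) (Finₚ.remQuot-combine {smallCount h} j k))

-- Names subtrees of bounded height by indices that have the same meaning at every node, so that
-- observations made at different cuts can be compared.
small-complete : ∀ {h} T → Within h T → ∃ λ i → small h i ≋ T
small-complete {zero}  T w = zero , pointwise λ u → sym (w u z≤n)
small-complete {suc h} T w
  with small-complete {h} (child T false) (λ u h≤ → w (false ∷ u) (s≤s h≤)) | small-complete {h} (child T true) (λ u h≤ → w (true ∷ u) (s≤s h≤))
... | j , e | k , e′ = combine (bit (label T [])) (combine j k) ,
  subst (_≋ T) (sym (small-combine h (bit (label T [])) j k)) (pointwise eq)
  where
  eq : label (node (unbit (bit (label T []))) (small h j) (small h k)) ≗ label T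
  eq []          = unbit-bit (label T [])
  eq (false ∷ v) = at e v
  eq (true ∷ v)  = at e′ v

infix 4 _≋?_
_≋?_ : (S T : FS) → Dec (S ≋ T)
S ≋? T with All.all? (λ w → label S w 𝔹ₚ.≟ label T w) (words (height S ⊔ height T))
... | no n  = no λ e → n (All.universal (at e) _)
... | yes a = yes (pointwise eq)
  where
  eq : ∀ w → label S w ≡ label T w
  eq w with length w <? height S ⊔ height T
  ... | yes l = All.lookup a (∈-words w l)
  ... | no l  = let h = ℕₚ.≮⇒≥ l in
    trans (blank S w (ℕₚ.m⊔n≤o⇒m≤o _ _ h)) (sym (blank T w (ℕₚ.m⊔n≤o⇒n≤o (height S) _ h)))

sameContext? : ∀ v (S T : FS) → Dec (SameContext v S T)
sameContext? v S T = map⇔ (mk⇔ (sameContext {v = v} {S} {T} {empty} {empty}) (λ h → h empty)) (graft S v empty ≋? graft T v empty)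

¬¬-bind : {A B : Set} → ¬ ¬ A → (A → ¬ ¬ B) → ¬ ¬ B
¬¬-bind m f n = m (λ a → f a n)

¬¬-pure : {A : Set} → A → ¬ ¬ A
¬¬-pure a n = n a

-- Double negation passes through finite products. For this reason every family of classical choices
-- below is indexed by some `Fin`.
¬¬-∀ : ∀ n {P : Fin n → Set} → (∀ i → ¬ ¬ P i) → ¬ ¬ (∀ i → P i)
¬¬-∀ zero    h n = n λ ()
¬¬-∀ (suc k) h = ¬¬-bind (h zero) λ p → ¬¬-bind (¬¬-∀ k (h ∘ suc)) λ ps → ¬¬-pure λ { zero → p ; (suc i) → ps i }

-- x₀ only fills the places left over when fewer than k elements are needed.
cover : {X : Set} (x₀ : X) {_~_ : X → X → Set} → (∀ x y → Dec (x ~ y)) → ∀ k (P : X → Set)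
  → (∀ (t : Fin k → X) → (∀ i → P (t i)) → (∀ {i j} → i Fin.< j → ¬ (t i ~ t j)) → ⊥)
  → ¬ ¬ (∃ λ (o : Fin k → X) → ∀ x → P x → ∃ λ j → o j ~ x)
cover x₀ ~? zero    P none = ⊥-elim (none (λ ()) (λ ()) λ { {()} })
cover x₀ {_~_} ~? (suc k) P none = ¬¬-bind ¬¬-excluded-middle λ
  { (no empty) → ¬¬-pure ((λ _ → x₀) , λ x px → ⊥-elim (empty (x , px)))
  -- Greedy choice: x is kept, and among the elements unrelated to x there are no k that are
  -- pairwise apart, since x could be put in front of them.
  ; (yes (x , px)) → ¬¬-bind (cover x₀ ~? k (λ y → P y × ¬ (x ~ y))
      (λ t pt apart → none (extend x t) (λ { zero → px ; (suc i) → proj₁ (pt i) })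
        λ { {zero} {suc j} _ → proj₂ (pt j) ; {suc i} {suc j} (s≤s i<j) → apart i<j }))
      λ (o , c) → ¬¬-pure (extend x o , λ y py → pick (~? x y) py (c y)) }
  where
  pick : ∀ {x y o} → Dec (x ~ y) → P y → (P y × ¬ (x ~ y) → ∃ λ j → o j ~ y) → ∃ λ j → extend {k} x o j ~ y
  pick (yes e) py c = zero , e
  pick (no n)  py c = let j , e = c (py , n) in suc j , e

-- A finite invariant that refines the relation. Its `count` serves once as the bound in a
-- pigeonhole argument and once as the number of states of the automaton for R.
record Observation {X : Set} (_~_ : X → X → Set) : Set where
  field
    count  : ℕ
    encode : X → Fin count
    sound  : ∀ {x y} → encode x ≡ encode y → x ~ y
open Observation

module _ {X : Set} where

  observe : ∀ {n} (g : X → Fin n) → Observation (λ x y → g x ≡ g y)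
  observe {n} g = record { count = n ; encode = g ; sound = id }

  observeBool : (g : X → Bool) → Observation (λ x y → g x ≡ g y)
  observeBool g = record { count = 2 ; encode = bit ∘ g
    ; sound = λ e → trans (sym (unbit-bit _)) (trans (cong unbit e) (unbit-bit _)) }

  infixr 4 _⊗_
  _⊗_ : {_~_ _~′_ : X → X → Set} → Observation _~_ → Observation _~′_ → Observation (λ x y → x ~ y × x ~′ y)
  O ⊗ O′ = record { count = count O * count O′ ; encode = λ x → combine (encode O x) (encode O′ x)
    ; sound = λ e → let e₁ , e₂ = Finₚ.combine-injective _ _ _ _ e in sound O e₁ , sound O′ e₂ }

  observe-∀ : ∀ n {c} {R : Fin n → X → X → Set} (O : ∀ i → Observation (R i)) → (∀ i → count (O i) ≡ c)
    → Observation (λ x y → ∀ i → R i x y)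
  observe-∀ n {c} {R} O e = record { count = c ^ n ; encode = λ x → funToFin (enc x) ; sound = λ {x} {y} h i →
      sound (O i) (cast-injective (e i) (trans (sym (Finₚ.finToFun-funToFin (enc x) i))
        (trans (cong (λ k → finToFun k i) h) (Finₚ.finToFun-funToFin (enc y) i)))) }
    where
    enc : X → Fin n → Fin c
    enc x i = subst Fin (e i) (encode (O i) x)
    cast-injective : ∀ {a b} (eq : a ≡ b) {p q : Fin a} → subst Fin eq p ≡ subst Fin eq q → p ≡ q
    cast-injective refl h = h

tracks-graft : ∀ {k} (Ts : Fin k → FS) v (Ys : Fin k → FS)
  → tracks (λ i → graft (Ts i) v (Ys i)) ≋ graft (tracks Ts) v (tracks Ys)
tracks-graft {k} Ts v Ys = pointwise (go v (label ∘ Ts) (label ∘ Ys))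
  where
  go : ∀ v (ls ms : Fin k → Word → Bool) w → tabulate (λ i → graftLabel v (ls i) (ms i) w)
    ≡ graftLabel v (λ w → tabulate (λ i → ls i w)) (λ w → tabulate (λ i → ms i w)) w
  go []          ls ms w           = refl
  go (b ∷ v)     ls ms []          = refl
  go (false ∷ v) ls ms (false ∷ w) = go v (λ i → ls i ∘ (false ∷_)) ms w
  go (false ∷ v) ls ms (true ∷ w)  = refl
  go (true ∷ v)  ls ms (false ∷ w) = refl
  go (true ∷ v)  ls ms (true ∷ w)  = go v (λ i → ls i ∘ (true ∷_)) ms w

module _ {k} (A : Automaton (replicate k false)) where

  state-tracks : (Ts : Fin k → FS) (v : Word) (Ys Ss : Fin k → FS) → (∀ i → Ss i ≋ graft (Ts i) v (Ys i))
    → state A (tracks Ss) ≡ context A v (tracks Ts) (state A (tracks Ys))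
  state-tracks Ts v Ys Ss e = trans (state-cong A (≋-trans (tracks-cong e) (tracks-graft Ts v Ys)))
    (state-graft A (tracks Ts) v (tracks Ys))

  state-self : (Ts : Fin k → FS) (v : Word) → state A (tracks Ts) ≡ context A v (tracks Ts) (state A (tracks (λ i → sub (Ts i) v)))
  state-self Ts v = state-tracks Ts v (λ i → sub (Ts i) v) Ts (λ i → ≋-sym (graft-self (Ts i) v))

pair-≋ : {S S′ T T′ : FS} → S ≋ S′ → T ≋ T′ → ∀ i → pair S T i ≋ pair S′ T′ i
pair-≋ e e′ zero       = e
pair-≋ e e′ (suc zero) = e′

m<2^m : ∀ m → m < 2 ^ m
m<2^m zero    = s≤s z≤n
m<2^m (suc m) = ℕₚ.+-mono-≤ (ℕₚ.≤-trans (s≤s z≤n) (m<2^m m)) (ℕₚ.≤-trans (m<2^m m) (ℕₚ.m≤m+n (2 ^ m) 0))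

opaque
  gridSide : ℕ → ℕ
  gridSide m = suc (suc (m + m))

  corner : ∀ m → Fin (gridSide m)
  corner m = zero

  -- More subsets of a square of side p = 2m + 2 than pairs of a vector of p
  -- states out of m and a vector of p sets of states.
  grid-count : ∀ m → m ^ gridSide m * (2 ^ m) ^ gridSide m < 2 ^ (gridSide m * gridSide m)
  grid-count m = begin-strict
    m ^ p * (2 ^ m) ^ p         ≤⟨ ℕₚ.*-monoˡ-≤ ((2 ^ m) ^ p) (ℕₚ.^-monoˡ-≤ p (ℕₚ.<⇒≤ (m<2^m m))) ⟩
    (2 ^ m) ^ p * (2 ^ m) ^ p   ≡⟨ cong₂ _*_ (ℕₚ.^-*-assoc 2 m p) (ℕₚ.^-*-assoc 2 m p) ⟩
    2 ^ (m * p) * 2 ^ (m * p)   ≡⟨ ℕₚ.^-distribˡ-+-* 2 (m * p) (m * p) ⟨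
    2 ^ (m * p + m * p)         ≡⟨ cong (2 ^_) (ℕₚ.*-distribʳ-+ p m m) ⟨
    2 ^ ((m + m) * p)           <⟨ ℕₚ.^-monoʳ-< 2 (s≤s (s≤s z≤n)) (ℕₚ.*-monoˡ-< p (ℕₚ.m≤n⇒m≤1+n (ℕₚ.n<1+n (m + m)))) ⟩
    2 ^ (p * p)                 ∎
    where
    open ℕₚ.≤-Reasoning
    p : ℕ
    p = gridSide m

opaque
  bounded-repeats : ∀ {t} (g : ℕ → ℕ) → (∀ k → g k ≤ t) → ∃₂ λ k l → k < l × g k ≡ g l
  bounded-repeats {t} g g≤t =
    let k , l , k<l , e = Finₚ.pigeonhole (ℕₚ.n<1+n (suc t)) (λ k → fromℕ< (s≤s (g≤t (toℕ k))))
    in toℕ k , toℕ l , k<l , Finₚ.fromℕ<-injective _ _ _ _ e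

-- Codes of numbers and their relative depth

module Codes (𝒫 : Presentation) where
  open Definability 𝒫
  open DefinableRelations 𝒫

  A : ℕ → FS
  A s = code [ s ]

  A-injective : ∀ {s t} → A s ≋ A t → s ≡ t
  A-injective e = singleton-injective (code-injective e)

  opaque
    d-number : Def {1} (λ ρ → IsNumber (ρ zero))
    d-number = def-IsNumber (var zero)

    d-domain : Def {1} (λ ρ → ⊤)
    d-domain = def-⊤

    d-less : Def {2} (λ ρ → LessEq (ρ zero) (ρ (suc zero)))
    d-less = def-LessEq (var zero) (var (suc zero))

    d-successor : Def {2} (λ ρ → SuccW (ρ zero) (ρ (suc zero)))
    d-successor = def-succ (var zero) (var (suc zero))

    d-inclusion : Def {2} (λ ρ → ρ zero ⊆ ρ (suc zero))
    d-inclusion = def-⊆ (var zero) (var (suc zero))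

  opaque
    numberᴬ domainᴬ : Automaton (replicate 1 false)
    numberᴬ = codesOf d-number
    domainᴬ = codesOf d-domain

    lessᴬ successorᴬ inclusionᴬ : Automaton (replicate 2 false)
    lessᴬ      = codesOf d-less
    successorᴬ = codesOf d-successor
    inclusionᴬ = codesOf d-inclusion

    accepts-number : ∀ T → Accepts numberᴬ (tracks (single T)) ⇔ (∃ λ s → A s ≋ T)
    accepts-number T = ⇔-trans (accepts-codesOf d-number (single T)) (mk⇔
      (λ (us , e , s , e′) → s , ≋-trans (code-cong (≈ˢ-sym e′)) (e zero))
      (λ (s , e) → single [ s ] , (λ { zero → e }) , s , ≈ˢ-refl))

    accepts-domain : ∀ T → Accepts domainᴬ (tracks (single T)) ⇔ (∃ λ X → code X ≋ T)
    accepts-domain T = ⇔-trans (accepts-codesOf d-domain (single T)) (mk⇔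
      (λ (us , e , _) → us zero , e zero) (λ (X , e) → single X , (λ { zero → e }) , tt))

    accepts-less : ∀ S T → Accepts lessᴬ (tracks (pair S T)) ⇔ (∃₂ λ s t → A s ≋ S × A t ≋ T × s ≤ t)
    accepts-less S T = ⇔-trans (accepts-codesOf d-less (pair S T)) (mk⇔
      (λ (us , e , s , t , e₁ , e₂ , s≤t) → s , t , ≋-trans (code-cong (≈ˢ-sym e₁)) (e zero) ,
        ≋-trans (code-cong (≈ˢ-sym e₂)) (e (suc zero)) , s≤t)
      (λ (s , t , e₁ , e₂ , s≤t) → pair [ s ] [ t ] , (λ { zero → e₁ ; (suc zero) → e₂ }) , s , t , ≈ˢ-refl , ≈ˢ-refl , s≤t))

    accepts-successor : ∀ S T → Accepts successorᴬ (tracks (pair S T)) ⇔ (∃ λ s → A s ≋ S × A (suc s) ≋ T)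
    accepts-successor S T = ⇔-trans (accepts-codesOf d-successor (pair S T)) (mk⇔
      (λ (us , e , s , e₁ , e₂) → s , ≋-trans (code-cong (≈ˢ-sym e₁)) (e zero) , ≋-trans (code-cong (≈ˢ-sym e₂)) (e (suc zero)))
      (λ (s , e₁ , e₂) → pair [ s ] [ suc s ] , (λ { zero → e₁ ; (suc zero) → e₂ }) , s , ≈ˢ-refl , ≈ˢ-refl))

    accepts-inclusion : ∀ s X → Accepts inclusionᴬ (tracks (pair (A s) (code X))) ⇔ (s ∈ X)
    accepts-inclusion s X = ⇔-trans (accepts-codesOf d-inclusion (pair (A s) (code X))) (mk⇔
      (λ (us , e , h) → proj₁ (code-injective (e (suc zero))) (h (proj₂ (code-injective (e zero)) (here refl))))
      (λ h → pair [ s ] X , (λ { zero → ≋-refl ; (suc zero) → ≋-refl }) , λ { (here refl) → h }))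

  -- A larger number has a code that is deeper, up to a constant, everywhere:
  -- otherwise pumping would give infinitely many numbers below it.
  slack : ℕ
  slack = size lessᴬ

  within-less₀ : ∀ {s t} v → s ≤ t → Within 0 (sub (A t) v) → Within slack (sub (A s) v)
  within-less₀ {s} {t} v s≤t blank-t with deepest (sub (A s) v)
  ... | inj₁ w = within-mono {T = sub (A s) v} z≤n w
  ... | inj₂ (u , u∈ , w) with slack ≤? length u
  ...   | no short  = within-mono {T = sub (A s) v} (ℕₚ.≰⇒> short) w
  ...   | yes long = ⊥-elim absurd
    where
    -- Below v the second track is blank, so pumping can act on the first track alone. Every result
    -- is accepted next to `A t` and hence codes a number at most t.
    first : Automaton false
    first = relabel lessᴬ false (λ b → b ∷ false ∷ []) refl

    state-first : ∀ T → state first T ≡ state lessᴬ (tracks (pair T empty))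
    state-first T = state-relabel lessᴬ (λ b → b ∷ false ∷ []) refl {T} (λ _ → refl)

    pumped = pump first (sub (A s) v) u u∈ w long
    F = proj₁ pumped

    blank-eq : sub (A t) v ≋ empty
    blank-eq = pointwise λ x → blank-t x z≤n

    state-F : ∀ k → state lessᴬ (tracks (pair (F k) empty)) ≡ state lessᴬ (tracks (pair (sub (A s) v) (sub (A t) v)))
    state-F k = trans (sym (state-first (F k))) (trans (proj₁ (proj₂ pumped) k) (trans (state-first (sub (A s) v))
      (state-cong lessᴬ (tracks-cong (pair-≋ ≋-refl (≋-sym blank-eq))))))

    accepted : ∀ k → Accepts lessᴬ (tracks (pair (graft (A s) v (F k)) (A t)))
    accepted k = subst (λ q → accepting lessᴬ q ≡ true) (sym eq) (from (accepts-less (A s) (A t)) (s , t , ≋-refl , ≋-refl , s≤t))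
      where
      graft-t : A t ≋ graft (A t) v empty
      graft-t = ≋-trans (≋-sym (graft-self (A t) v)) (graft-cong v ≋-refl blank-eq)
      eq : state lessᴬ (tracks (pair (graft (A s) v (F k)) (A t))) ≡ state lessᴬ (tracks (pair (A s) (A t)))
      eq = trans (state-tracks lessᴬ (pair (A s) (A t)) v (pair (F k) empty) _ λ { zero → ≋-refl ; (suc zero) → graft-t })
        (trans (cong (context lessᴬ v _) (state-F k))
        (sym (state-tracks lessᴬ (pair (A s) (A t)) v (pair (sub (A s) v) (sub (A t) v)) _
          λ { zero → ≋-sym (graft-self (A s) v) ; (suc zero) → ≋-sym (graft-self (A t) v) })))

    below : ∀ k → ∃ λ i → i ≤ t × A i ≋ graft (A s) v (F k)
    below k with to (accepts-less _ _) (accepted k)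
    ... | i , j , e , e′ , i≤j with A-injective e′
    ... | refl = i , i≤j , e

    absurd : ⊥
    absurd = let k , l , k<l , e = bounded-repeats (proj₁ ∘ below) (proj₁ ∘ proj₂ ∘ below) in
      proj₂ (proj₂ pumped) k<l (≋-trans (≋-sym (sub-graft (A s) v (F k))) (≋-trans (sub-cong (same k l e) v) (sub-graft (A s) v (F l))))
      where
      same : ∀ k l → proj₁ (below k) ≡ proj₁ (below l) → graft (A s) v (F k) ≋ graft (A s) v (F l)
      same k l e = ≋-trans (≋-sym (proj₂ (proj₂ (below k))))
        (subst (λ i → A i ≋ graft (A s) v (F l)) (sym e) (proj₂ (proj₂ (below l))))

  -- At h levels below v the tree `A t` has become blank, and the preceding case applies at that
  -- node.
  within-less : ∀ {s t} h v → s ≤ t → Within h (sub (A t) v) → Within (h + slack) (sub (A s) v)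
  within-less {s} {t} h v s≤t wt w hw = trans (cong (label (A s)) split)
    (within-less₀ (v ++ take h w) s≤t blank-below (drop h w) long)
    where
    split : v ++ w ≡ (v ++ take h w) ++ drop h w
    split = trans (cong (v ++_) (sym (Listₚ.take++drop≡id h w))) (sym (Listₚ.++-assoc v (take h w) (drop h w)))
    blank-below : Within 0 (sub (A t) (v ++ take h w))
    blank-below x _ = trans (cong (label (A t)) (Listₚ.++-assoc v (take h w) x)) (wt (take h w ++ x)
      (subst (h ≤_) (sym (trans (Listₚ.length-++ (take h w)) (cong (_+ length x) (length-take-≤ w (ℕₚ.m+n≤o⇒m≤o h hw)))))
        (ℕₚ.m≤m+n h (length x))))
    long : slack ≤ length (drop h w)
    long = subst (slack ≤_) (sym (Listₚ.length-drop h w)) (ℕₚ.m+n≤o⇒m≤o∸n slack (subst (_≤ length w) (ℕₚ.+-comm h slack) hw))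

opaque
  collision : ∀ {a b} → a < b → (g : Fin b → Fin a) → ∃₂ λ i j → i ≢ j × g i ≡ g j
  collision a<b g = let i , j , i<j , e = Finₚ.pigeonhole a<b g in i , j , Finₚ.<⇒≢ i<j , e

Tall : ℕ → FS → Set
Tall h T = ∃ λ u → label T u ≡ true × Within (suc (length u)) T × h ≤ length u

within⊎tall : ∀ h T → Within h T ⊎ Tall h T
within⊎tall h T with deepest T
... | inj₁ w = inj₁ (within-mono {T = T} z≤n w)
... | inj₂ (u , u∈ , w) with h ≤? length u
...   | yes long = inj₂ (u , u∈ , w , long)
...   | no short = inj₁ (within-mono {T = T} (ℕₚ.≰⇒> short) w)

-- Cut nodes and the contexts around them

module Cutting (𝒫 : Presentation) where
  open Definability 𝒫
  open Codes 𝒫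

  -- Pumping with `numberᴬ` needs a path of length `tallness`. Placing v at distance
  -- `tallness + slack` above a deepest node of `A n` secures such a path in every later code, since
  -- by `within-less` a shorter one would make `A n` too shallow at v. The successor in `cutHeight`
  -- is there because `Within` bounds depths strictly.
  tallness cutHeight : ℕ
  tallness  = size numberᴬ
  cutHeight = suc (tallness + slack)

  -- A node v of the tree A n, at bounded distance above its deepest node, such
  -- that (unless v is the root) all later codes are tall at v.
  CutNode : ℕ → Word → Set
  CutNode n v = Within cutHeight (sub (A n) v) × (v ≡ [] ⊎ (∀ {t} → n ≤ t → Tall tallness (sub (A t) v)))

  opaque
    cutNode : ∀ n → ∃ (CutNode n)
    cutNode n with within⊎tall cutHeight (A n)
    ... | inj₁ w = [] , (λ x → w x) , inj₁ refl
    ... | inj₂ (u , u∈ , w , long) = v , low , inj₂ tall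
      where
      k : ℕ
      k = length u ∸ (tallness + slack)
      v : Word
      v = take k u
      k≤u : k ≤ length u
      k≤u = ℕₚ.m∸n≤m (length u) (tallness + slack)
      k+ : k + (tallness + slack) ≡ length u
      k+ = ℕₚ.m∸n+n≡m (ℕₚ.<⇒≤ long)
      low : Within cutHeight (sub (A n) v)
      low x h = w (v ++ x) (subst₂ _≤_ (trans (ℕₚ.+-suc k (tallness + slack)) (cong suc k+))
        (sym (trans (Listₚ.length-++ v) (cong (_+ length x) (length-take-≤ u k≤u)))) (ℕₚ.+-monoʳ-≤ k h))
      deep-n : label (sub (A n) v) (drop k u) ≡ true
      deep-n = trans (cong (label (A n)) (Listₚ.take++drop≡id k u)) u∈
      length-deep : length (drop k u) ≡ tallness + slack
      length-deep = trans (Listₚ.length-drop k u) (trans (cong (_∸ k) (sym k+)) (ℕₚ.m+n∸m≡n k (tallness + slack)))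
      tall : ∀ {t} → n ≤ t → Tall tallness (sub (A t) v)
      tall {t} n≤t with within⊎tall tallness (sub (A t) v)
      ... | inj₂ r  = r
      ... | inj₁ wt = contradiction (trans (sym deep-n)
              (within-less tallness v n≤t wt (drop k u) (ℕₚ.≤-reflexive (sym length-deep)))) λ ()

  private
    m = size inclusionᴬ

  side : ℕ
  side = gridSide m

  -- Pumping the subtrees at v of numbers with `side` different contexts gives
  -- a square of numbers, but inclusion reads the two coordinates separately.
  module Grid (v : Word) (q : Fin tallness) (t : Fin side → ℕ)
    (same-state : ∀ j → state numberᴬ (tracks (single (sub (A (t j)) v))) ≡ q)
    (tall : Tall tallness (sub (A (t (corner m))) v))
    (apart : ∀ {i j} → i Fin.< j → ¬ SameContext v (A (t i)) (A (t j))) where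

    private
      alone : Automaton false
      alone = relabel numberᴬ false (λ b → b ∷ []) refl

      state-alone : ∀ T → state alone T ≡ state numberᴬ (tracks (single T))
      state-alone T = state-relabel numberᴬ (λ b → b ∷ []) refl {T} (λ _ → refl)

      -- Any of the subtrees could be pumped: all have the state q, so the pumped trees fit into
      -- every one of the contexts.
      T₀ = sub (A (t (corner m))) v
      pumped = pump alone T₀ (proj₁ tall) (proj₁ (proj₂ tall)) (proj₁ (proj₂ (proj₂ tall))) (proj₂ (proj₂ (proj₂ tall)))

      F : ℕ → FS
      F = proj₁ pumped

      point-at : Fin side → Fin side → FS
      point-at j l = graft (A (t j)) v (F (toℕ l))

      accepted : ∀ j l → Accepts numberᴬ (tracks (single (point-at j l)))
      accepted j l = subst (λ q → accepting numberᴬ q ≡ true) (sym eq) (from (accepts-number (A (t j))) (t j , ≋-refl))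
        where
        eq : state numberᴬ (tracks (single (point-at j l))) ≡ state numberᴬ (tracks (single (A (t j))))
        eq = trans (state-tracks numberᴬ (single (A (t j))) v (single (F (toℕ l))) (single (point-at j l)) λ { zero → ≋-refl })
          (trans (cong (context numberᴬ v (tracks (single (A (t j)))))
            (trans (sym (state-alone (F (toℕ l)))) (trans (proj₁ (proj₂ pumped) (toℕ l)) (trans (state-alone T₀)
              (trans (same-state (corner m)) (sym (same-state j)))))))
          (sym (state-tracks numberᴬ (single (A (t j))) v (single (sub (A (t j)) v)) (single (A (t j)))
            λ { zero → ≋-sym (graft-self (A (t j)) v) })))

      number-at : ∀ j l → ∃ λ s → A s ≋ point-at j l
      number-at j l = to (accepts-number (point-at j l)) (accepted j l)

      num : Fin side → Fin side → ℕ
      num j l = proj₁ (number-at j l)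

      num-injective : ∀ {j l j′ l′} → num j l ≡ num j′ l′ → j ≡ j′ × l ≡ l′
      num-injective {j} {l} {j′} {l′} e = row , column
        where
        same : point-at j l ≋ point-at j′ l′
        same = ≋-trans (≋-sym (proj₂ (number-at j l))) (subst (λ s → A s ≋ point-at j′ l′) (sym e) (proj₂ (number-at j′ l′)))
        sameF : F (toℕ l) ≋ F (toℕ l′)
        sameF = ≋-trans (≋-sym (sub-graft (A (t j)) v (F (toℕ l)))) (≋-trans (sub-cong same v) (sub-graft (A (t j′)) v (F (toℕ l′))))
        row : j ≡ j′
        row with Finₚ.<-cmp j j′
        ... | tri< lt _ _ = ⊥-elim (apart lt (sameContext same))
        ... | tri≈ _ eq _ = eq
        ... | tri> _ _ gt = ⊥-elim (apart gt (sameContext (≋-sym same)))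
        column : l ≡ l′
        column with Finₚ.<-cmp l l′
        ... | tri< lt _ _ = ⊥-elim (proj₂ (proj₂ pumped) lt sameF)
        ... | tri≈ _ eq _ = eq
        ... | tri> _ _ gt = ⊥-elim (proj₂ (proj₂ pumped) gt (≋-sym sameF))

      Cell : Set
      Cell = Fin (side * side)

      row column : Cell → Fin side
      row e    = proj₁ (remQuot {side} side e)
      column e = proj₂ (remQuot {side} side e)

      cell : Cell → ℕ
      cell e = num (row e) (column e)

      cell-injective : ∀ {e e′} → cell e ≡ cell e′ → e ≡ e′
      cell-injective {e} {e′} h = let h₁ , h₂ = num-injective h in
        trans (sym (Finₚ.combine-remQuot {side} side e)) (trans (cong₂ combine h₁ h₂) (Finₚ.combine-remQuot {side} side e′))

      setOf : Fin (2 ^ (side * side)) → FinSet ℕ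
      setOf S = map cell (filter (λ e → member S e 𝔹ₚ.≟ true) (allFin (side * side)))

      ∈-setOf : ∀ S e → (cell e ∈ setOf S) ⇔ (member S e ≡ true)
      ∈-setOf S e = mk⇔ there′ (λ h → ∈ₚ.∈-map⁺ cell (∈ₚ.∈-filter⁺ (λ e → member S e 𝔹ₚ.≟ true) (∈ₚ.∈-allFin e) h))
        where
        there′ : cell e ∈ setOf S → member S e ≡ true
        there′ h with ∈ₚ.∈-map⁻ cell h
        ... | e′ , i , eq with cell-injective {e} {e′} eq
        ... | refl = proj₂ (∈ₚ.∈-filter⁻ (λ e → member S e 𝔹ₚ.≟ true) {xs = allFin (side * side)} i)

      -- For the cell in row j and column l, the state below v depends on l and S, and what the
      -- context does with a state depends on j and S. No part of the observation sees both
      -- coordinates.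
      inner : Fin side → Fin (2 ^ (side * side)) → Fin m
      inner l S = state inclusionᴬ (tracks (pair (F (toℕ l)) (sub (code (setOf S)) v)))

      outer : Fin side → Fin m → Fin (2 ^ (side * side)) → Bool
      outer j s S = accepting inclusionᴬ (context inclusionᴬ v (tracks (pair (A (t j)) (code (setOf S)))) s)

      member-inner-outer : ∀ S e → (member S e ≡ true) ⇔ (outer (row e) (inner (column e) S) S ≡ true)
      member-inner-outer S e = ⇔-trans (⇔-sym (∈-setOf S e)) (⇔-trans (⇔-sym (accepts-inclusion (cell e) (setOf S)))
        (mk⇔ (subst (λ s → accepting inclusionᴬ s ≡ true) eq) (subst (λ s → accepting inclusionᴬ s ≡ true) (sym eq))))
        where
        eq : state inclusionᴬ (tracks (pair (A (cell e)) (code (setOf S))))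
          ≡ context inclusionᴬ v (tracks (pair (A (t (row e))) (code (setOf S)))) (inner (column e) S)
        eq = state-tracks inclusionᴬ (pair (A (t (row e))) (code (setOf S))) v
          (pair (F (toℕ (column e))) (sub (code (setOf S)) v)) (pair (A (cell e)) (code (setOf S)))
          λ { zero → proj₂ (number-at (row e) (column e)) ; (suc zero) → ≋-sym (graft-self (code (setOf S)) v) }

      -- Its count computes to the left side of `grid-count`: a vector of states for the columns and
      -- a vector of sets of states for the rows.
      O = observe-∀ side (λ l → observe (inner l)) (λ _ → refl)
        ⊗ observe-∀ side (λ j → observe-∀ m (λ s → observeBool (outer j s)) (λ _ → refl)) (λ _ → refl)

    impossible : ⊥
    impossible = let S , S′ , S≢S′ , e = collision (grid-count m) (encode O) in S≢S′ (determined S S′ (sound O {S} {S′} e))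
      where
      determined : ∀ S S′ → (∀ l → inner l S ≡ inner l S′) × (∀ j s → outer j s S ≡ outer j s S′) → S ≡ S′
      determined S S′ (e₁ , e₂) =
        trans (sym (subset-member {side * side} S)) (trans (subset-cong same) (subset-member {side * side} S′))
        where
        values : ∀ e → outer (row e) (inner (column e) S) S ≡ outer (row e) (inner (column e) S′) S′
        values e = trans (cong (λ s → outer (row e) s S) (e₁ (column e))) (e₂ (row e) (inner (column e) S′))
        same : ∀ e → member S e ≡ member S′ e
        same e = bool-ext
          (λ h → from (member-inner-outer S′ e) (trans (sym (values e)) (to (member-inner-outer S e) h)))
          (λ h → from (member-inner-outer S e) (trans (values e) (to (member-inner-outer S′ e) h)))

  -- The grid argument needs equal states below v. Contexts are therefore sorted by that state, and
  -- each of the `tallness` classes is covered by `side` representatives.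
  contextCount : ℕ
  contextCount = tallness * side

  Covers : (n : ℕ) (v : Word) → (Fin contextCount → ℕ) → Set
  Covers n v o = ∀ {t} → n ≤ t → ∃ λ e → SameContext v (A (o e)) (A t)

  opaque
    contexts : ∀ {n v} → CutNode n v → ¬ ¬ ∃ (Covers n v)
    -- Nothing lies outside the subtree at the root, so a single context serves under an arbitrary
    -- index.
    contexts {n} {v} (_ , inj₁ refl) = ¬¬-pure ((λ _ → n) , λ {t} n≤t → combine (start numberᴬ) (corner m) , λ Y → pointwise λ _ → refl)
    contexts {n} {v} (_ , inj₂ tall) = ¬¬-bind
      (¬¬-∀ tallness λ q → cover n {λ s t → SameContext v (A s) (A t)} (λ s t → sameContext? v (A s) (A t)) side
        (λ t → n ≤ t × stateAt t ≡ q)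
        (λ t ok apart → Grid.impossible v q t (proj₂ ∘ ok) (tall (proj₁ (ok (corner m)))) apart))
      λ c → ¬¬-pure ((λ e → let q , j = remQuot {tallness} side e in proj₁ (c q) j) , λ {t} n≤t →
        let j , same = proj₂ (c (stateAt t)) t (n≤t , refl)
        in combine (stateAt t) j ,
           subst (λ qj → SameContext v (A (proj₁ (c (proj₁ qj)) (proj₂ qj))) (A t)) (sym (Finₚ.remQuot-combine {tallness} {side} (stateAt t) j)) same)
      where
      stateAt : ℕ → Fin tallness
      stateAt t = state numberᴬ (tracks (single (sub (A t) v)))

-- Residuals of a definable relation

-- Concatenation in the reading of sets as words: the first n positions of X, then Y. The residual
-- of the prefix is R as a predicate of Y.
join : ℕ → FinSet ℕ → FinSet ℕ → FinSet ℕ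
join n X Y = filter (_<? n) X ++ map (_+ n) Y

∈-join : ∀ {n X Y z} → (z ∈ join n X Y) ⇔ ((z < n × z ∈ X) ⊎ (∃ λ i → i ∈ Y × z ≡ i + n))
∈-join {n} {X} {Y} = mk⇔ there′ back
  where
  there′ : ∀ {z} → z ∈ join n X Y → (z < n × z ∈ X) ⊎ (∃ λ i → i ∈ Y × z ≡ i + n)
  there′ h with ∈ₚ.∈-++⁻ (filter (_<? n) X) h
  ... | inj₁ h₁ = let a , b = ∈ₚ.∈-filter⁻ (_<? n) {xs = X} h₁ in inj₁ (b , a)
  ... | inj₂ h₂ = inj₂ (∈ₚ.∈-map⁻ (_+ n) h₂)
  back : ∀ {z} → (z < n × z ∈ X) ⊎ (∃ λ i → i ∈ Y × z ≡ i + n) → z ∈ join n X Y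
  back (inj₁ (l , h))        = ∈ₚ.∈-++⁺ˡ (∈ₚ.∈-filter⁺ (_<? n) h l)
  back (inj₂ (i , h , refl)) = ∈ₚ.∈-++⁺ʳ (filter (_<? n) X) (∈ₚ.∈-map⁺ (_+ n) h)

join-below : ∀ {n X Y z} → z < n → (z ∈ join n X Y) ⇔ (z ∈ X)
join-below {n} {X} {Y} {z} l = mk⇔ (λ h → case (to (∈-join {n} {X} {Y}) h)) (λ h → from (∈-join {n} {X} {Y}) (inj₁ (l , h)))
  where
  case : (z < n × z ∈ X) ⊎ (∃ λ i → i ∈ Y × z ≡ i + n) → z ∈ X
  case (inj₁ (_ , h))        = h
  case (inj₂ (i , _ , refl)) = ⊥-elim (ℕₚ.<⇒≱ l (ℕₚ.m≤n+m n i))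

join-above : ∀ {n X Y i} → (i + n ∈ join n X Y) ⇔ (i ∈ Y)
join-above {n} {X} {Y} {i} = mk⇔ (λ h → case (to (∈-join {n} {X} {Y}) h)) (λ h → from (∈-join {n} {X} {Y}) (inj₂ (i , h , refl)))
  where
  case : (i + n < n × i + n ∈ X) ⊎ (∃ λ j → j ∈ Y × i + n ≡ j + n) → i ∈ Y
  case (inj₁ (l , _))     = ⊥-elim (ℕₚ.<⇒≱ l (ℕₚ.m≤n+m n i))
  case (inj₂ (j , h , e)) = subst (_∈ Y) (sym (ℕₚ.+-cancelʳ-≡ n i j e)) h

≈-join : ∀ {n X Y Z} → (∀ {z} → z < n → (z ∈ Z) ⇔ (z ∈ X)) → (∀ i → (i + n ∈ Z) ⇔ (i ∈ Y)) → Z ≈ˢ join n X Y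
≈-join {n} {X} {Y} {Z} low high = (λ {z} h → compare z h) , (λ {z} h → case z (to (∈-join {n} {X} {Y}) h))
  where
  compare : ∀ z → z ∈ Z → z ∈ join n X Y
  compare z h with z <? n
  ... | yes l = from (join-below {n} {X} {Y} l) (to (low l) h)
  ... | no l  = subst (_∈ join n X Y) e (from (join-above {n} {X} {Y}) (to (high (z ∸ n)) (subst (_∈ Z) (sym e) h)))
    where e = ℕₚ.m∸n+n≡m (ℕₚ.≮⇒≥ l)
  case : ∀ z → (z < n × z ∈ X) ⊎ (∃ λ i → i ∈ Y × z ≡ i + n) → z ∈ Z
  case z (inj₁ (l , h))        = from (low l) h
  case z (inj₂ (i , h , refl)) = from (high i) h

module Residuals (𝒫 : Presentation) {r : ℕ} {R : Env r → Set} (dR : DefinableIn 𝒫 R) where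
  open Definability 𝒫
  open Codes 𝒫
  open Cutting 𝒫

  relationᴬ : Automaton (replicate r false)
  relationᴬ = codesOf dR

  record Cut : Set where
    field
      position : ℕ
      place    : Word
      isNode   : CutNode position place
      origin   : Fin contextCount → ℕ
      covers   : Covers position place origin
  open Cut

  maxHeight : ℕ
  maxHeight = cutHeight + slack

  module _ (c : Cut) where

    low-sub : ∀ {s} → s ≤ position c → Within maxHeight (sub (A s) (place c))
    low-sub s≤n = within-less cutHeight (place c) s≤n (proj₁ (isNode c))

    -- Serves the numbers up to the cut position: their subtrees at the cut node are small by
    -- `low-sub`, so an index i stands for everything that they contribute there.
    inside : Fin (smallCount maxHeight) → FinSet ℕ → Fin (size inclusionᴬ)
    inside i X = state inclusionᴬ (tracks (pair (small maxHeight i) (sub (code X) (place c))))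

    insideDomain : FinSet ℕ → Fin (size domainᴬ)
    insideDomain X = state domainᴬ (tracks (single (sub (code X) (place c))))

    -- Serves the numbers from the cut position on: one of finitely many contexts surrounds a
    -- subtree that is not bounded, and all states s are tabulated in its place.
    outside : Fin contextCount → Fin (size inclusionᴬ) → FinSet ℕ → Bool
    outside j s X = accepting inclusionᴬ (context inclusionᴬ (place c) (tracks (pair (A (origin c j)) (code X))) s)

    outsideRelation : Fin (size relationᴬ) → Env r → Bool
    outsideRelation s Xs = accepting relationᴬ (context relationᴬ (place c) (tracks (code ∘ Xs)) s)

    firstContext : Fin contextCount
    firstContext = proj₁ (covers c ℕₚ.≤-refl)

    base : ∃ λ i → small maxHeight i ≋ sub (A (position c)) (place c)
    base = small-complete (sub (A (position c)) (place c)) (low-sub ℕₚ.≤-refl)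

    -- A finite table of the successor relation across the cut node, through which `shift` carries
    -- codes from one cut to another.
    nextContext : Fin contextCount → Fin contextCount → Fin (size successorᴬ) → Bool
    nextContext j k s = accepting successorᴬ (context successorᴬ (place c) (tracks (pair (A (origin c j)) (A (origin c k)))) s)

  Point : Set
  Point = Cut × Env r

  SamePoint : Point → Point → Set
  SamePoint (c , Xs) (d , Zs) =
    (∀ k → (∀ i → inside c i (Xs k) ≡ inside d i (Zs k)) × (insideDomain c (Xs k) ≡ insideDomain d (Zs k))
         × (∀ j s → outside c j s (Xs k) ≡ outside d j s (Zs k)))
    × (∀ s → outsideRelation c s Xs ≡ outsideRelation d s Zs)

  opaque
    observePoint : Observation SamePoint
    observePoint =
      observe-∀ r (λ k →
        observe-∀ (smallCount maxHeight) (λ i → observe (λ (c , Xs) → inside c i (Xs k))) (λ _ → refl)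
        ⊗ observe (λ (c , Xs) → insideDomain c (Xs k))
        ⊗ observe-∀ contextCount (λ j → observe-∀ (size inclusionᴬ) (λ s → observeBool (λ (c , Xs) → outside c j s (Xs k)))
            (λ _ → refl)) (λ _ → refl)) (λ _ → refl)
      ⊗ observe-∀ (size relationᴬ) (λ s → observeBool (λ (c , Xs) → outsideRelation c s Xs)) (λ _ → refl)

  -- The sets `Zs` are the continuations of the prefix. The set of values t realised by them is a
  -- subset of a fixed finite set, and it is the essential part of the type of a prefix.
  Realised : Cut → Env r → Fin (count observePoint) → Set
  Realised c Xs t = ∃ λ Zs → (∀ k {z} → z < position c → (z ∈ Zs k) ⇔ (z ∈ Xs k)) × encode observePoint (c , Zs) ≡ t

  -- The field `decided` is supplied by excluded middle under ¬¬. Storing it makes the type of a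
  -- prefix computable, so that it can be an observation.
  record Prefix : Set where
    field
      cut     : Cut
      sets    : Env r
      decided : ∀ t → Dec (Realised cut sets t)
  open Prefix

  SameCut : Cut → Cut → Set
  SameCut c d = firstContext c ≡ firstContext d × proj₁ (base c) ≡ proj₁ (base d)
    × (∀ j k s → nextContext c j k s ≡ nextContext d j k s)

  SamePrefix : Prefix → Prefix → Set
  SamePrefix x y = SameCut (cut x) (cut y) × (∀ t → does (decided x t) ≡ does (decided y t))

  opaque
    observePrefix : Observation SamePrefix
    observePrefix =
      (observe (λ x → firstContext (cut x))
        ⊗ observe (λ x → proj₁ (base (cut x)))
        ⊗ observe-∀ contextCount (λ j → observe-∀ contextCount (λ k → observe-∀ (size successorᴬ)
            (λ s → observeBool (λ x → nextContext (cut x) j k s)) (λ _ → refl)) (λ _ → refl)) (λ _ → refl))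
      ⊗ observe-∀ (count observePoint) (λ t → observeBool (λ x → does (decided x t))) (λ _ → refl)

  opaque
    -- Induction on i. At the cut positions the small subtrees have equal names by `SameCut`.
    -- Afterwards the subtree of the next code at c is copied to d: equal `nextContext` tables make
    -- the successor automaton accept there too, and injectivity of codes identifies the number.
    shift : ∀ {c d} → SameCut c d → ∀ i → ∃₂ λ j Y →
      A (i + position c) ≋ graft (A (origin c j)) (place c) Y × A (i + position d) ≋ graft (A (origin d j)) (place d) Y
    shift {c} {d} (e₁ , e₂ , e₃) zero = firstContext c , sub (A (position c)) (place c) ,
      ≋-trans (≋-sym (graft-self (A (position c)) (place c))) (≋-sym (proj₂ (covers c ℕₚ.≤-refl) _)) ,
      subst (λ j → A (position d) ≋ graft (A (origin d j)) (place d) (sub (A (position c)) (place c))) (sym e₁)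
        (≋-trans (≋-sym (graft-self (A (position d)) (place d))) (≋-trans (graft-cong (place d) ≋-refl same-sub)
          (≋-sym (proj₂ (covers d ℕₚ.≤-refl) _))))
      where
      same-sub : sub (A (position d)) (place d) ≋ sub (A (position c)) (place c)
      same-sub = ≋-trans (≋-sym (proj₂ (base d)))
        (subst (λ i → small maxHeight i ≋ sub (A (position c)) (place c)) e₂ (proj₂ (base c)))
    shift {c} {d} s@(e₁ , e₂ , e₃) (suc i) with shift {c} {d} s i
    ... | j , Y , ec , ed = k , Y′ , ec′ , ed′
      where
      t : ℕ
      t = suc (i + position c)
      covered : ∃ λ k → SameContext (place c) (A (origin c k)) (A t)
      covered = covers c (ℕₚ.m≤n⇒m≤1+n (ℕₚ.m≤n+m (position c) i))
      k : Fin contextCount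
      k = proj₁ covered
      Y′ : FS
      Y′ = sub (A t) (place c)
      ec′ : A t ≋ graft (A (origin c k)) (place c) Y′
      ec′ = ≋-trans (≋-sym (graft-self (A t) (place c))) (≋-sym (proj₂ covered Y′))
      next-c : nextContext c j k (state successorᴬ (tracks (pair Y Y′))) ≡ true
      next-c = subst (λ s → accepting successorᴬ s ≡ true)
        (state-tracks successorᴬ (pair (A (origin c j)) (A (origin c k))) (place c) (pair Y Y′)
          (pair (A (i + position c)) (A t)) λ { zero → ec ; (suc zero) → ec′ })
        (from (accepts-successor (A (i + position c)) (A t)) (i + position c , ≋-refl , ≋-refl))
      G G′ : FS
      G  = graft (A (origin d j)) (place d) Y
      G′ = graft (A (origin d k)) (place d) Y′
      next-d : Accepts successorᴬ (tracks (pair G G′))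
      next-d = subst (λ s → accepting successorᴬ s ≡ true)
        (sym (state-tracks successorᴬ (pair (A (origin d j)) (A (origin d k))) (place d) (pair Y Y′)
          (pair G G′) λ { zero → ≋-refl ; (suc zero) → ≋-refl }))
        (trans (sym (e₃ j k _)) next-c)
      ed′ : A (suc (i + position d)) ≋ G′
      ed′ = let s , es , es′ = to (accepts-successor G G′) next-d in
        subst (λ s → A (suc s) ≋ G′) (A-injective (≋-trans es (≋-sym ed))) es′

  joinAll : Prefix → Env r → Env r
  joinAll x Ys k = join (position (cut x)) (sets x k) (Ys k)

  -- The codes of the joined sets at y are grafted from codes realising the
  -- same observations at y and the subtrees of the joined sets at x.
  opaque
    transfer : ∀ x y → SamePrefix x y → ∀ Ys → R (joinAll x Ys) → R (joinAll y Ys)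
    transfer x y (same , alike) Ys h = result (realised y-has)
      where
      c d : Cut
      c = cut x
      d = cut y
      u v : Word
      u = place c
      v = place d
      Zs : Env r
      Zs = joinAll x Ys
      t : Fin (count observePoint)
      t = encode observePoint (c , Zs)
      y-has : does (decided y t) ≡ true
      y-has = trans (sym (alike t)) (dec-true (decided x t) (Zs , (λ k l → join-below {position c} {sets x k} {Ys k} l) , refl))
      realised : does (decided y t) ≡ true → Realised d (sets y) t
      realised = does-true (decided y t)
      result : Realised d (sets y) t → R (joinAll y Ys)
      result (Zs′ , agree , e) = def-cong dR ≈joined relation-holds
        where
        point-eq : SamePoint (d , Zs′) (c , Zs)
        point-eq = sound observePoint {d , Zs′} {c , Zs} e
        inside≡ : ∀ k i → inside d i (Zs′ k) ≡ inside c i (Zs k)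
        inside≡ k = proj₁ (proj₁ point-eq k)
        domain≡ : ∀ k → insideDomain d (Zs′ k) ≡ insideDomain c (Zs k)
        domain≡ k = proj₁ (proj₂ (proj₁ point-eq k))
        outside≡ : ∀ k j s → outside d j s (Zs′ k) ≡ outside c j s (Zs k)
        outside≡ k = proj₂ (proj₂ (proj₁ point-eq k))
        G : Fin r → FS
        G k = graft (code (Zs′ k)) v (sub (code (Zs k)) u)
        coded : ∀ k → ∃ λ X → code X ≋ G k
        coded k = to (accepts-domain (G k)) (subst (λ s → accepting domainᴬ s ≡ true) (sym eq)
          (from (accepts-domain (code (Zs′ k))) (Zs′ k , ≋-refl)))
          where
          eq : state domainᴬ (tracks (single (G k))) ≡ state domainᴬ (tracks (single (code (Zs′ k))))
          eq = trans (state-tracks domainᴬ (single (code (Zs′ k))) v (single (sub (code (Zs k)) u)) (single (G k)) λ { zero → ≋-refl })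
            (trans (cong (context domainᴬ v (tracks (single (code (Zs′ k))))) (sym (domain≡ k)))
            (sym (state-tracks domainᴬ (single (code (Zs′ k))) v (single (sub (code (Zs′ k)) v)) (single (code (Zs′ k)))
              λ { zero → ≋-sym (graft-self (code (Zs′ k)) v) })))
        X : Env r
        X k = proj₁ (coded k)
        -- The number keeps its own context and its small subtree. By `inside≡` exchanging the
        -- subtree of the set does not change the state at v, so membership is that in `Zs′ k`.
        low : ∀ k {z} → z < position d → (z ∈ X k) ⇔ (z ∈ sets y k)
        low k {z} l = ⇔-trans (⇔-sym (accepts-inclusion z (X k))) (⇔-trans
          (mk⇔ (subst (λ s → accepting inclusionᴬ s ≡ true) eq) (subst (λ s → accepting inclusionᴬ s ≡ true) (sym eq)))
          (⇔-trans (accepts-inclusion z (Zs′ k)) (agree k l)))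
          where
          found : ∃ λ i → small maxHeight i ≋ sub (A z) v
          found = small-complete (sub (A z) v) (low-sub d (ℕₚ.<⇒≤ l))
          Y : FS
          Y = small maxHeight (proj₁ found)
          Az : A z ≋ graft (A z) v Y
          Az = ≋-trans (≋-sym (graft-self (A z) v)) (graft-cong v ≋-refl (≋-sym (proj₂ found)))
          eq : state inclusionᴬ (tracks (pair (A z) (code (X k)))) ≡ state inclusionᴬ (tracks (pair (A z) (code (Zs′ k))))
          eq = trans (state-tracks inclusionᴬ (pair (A z) (code (Zs′ k))) v (pair Y (sub (code (Zs k)) u)) (pair (A z) (code (X k)))
              λ { zero → Az ; (suc zero) → proj₂ (coded k) })
            (trans (cong (context inclusionᴬ v (tracks (pair (A z) (code (Zs′ k))))) (sym (inside≡ k (proj₁ found))))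
            (sym (state-tracks inclusionᴬ (pair (A z) (code (Zs′ k))) v (pair Y (sub (code (Zs′ k)) v)) (pair (A z) (code (Zs′ k)))
              λ { zero → Az ; (suc zero) → ≋-sym (graft-self (code (Zs′ k)) v) })))
        -- By `shift` both numbers have the subtree Y, so the states below the two nodes coincide,
        -- and `outside≡` compares the contexts.
        high : ∀ k i → (i + position d ∈ X k) ⇔ (i ∈ Ys k)
        high k i with shift {c} {d} same i
        ... | j , Y , ec , ed = ⇔-trans (⇔-sym (accepts-inclusion (i + position d) (X k))) (⇔-trans
            (mk⇔ (trans (sym eq)) (trans eq))
            (⇔-trans (accepts-inclusion (i + position c) (Zs k)) (join-above {position c} {sets x k} {Ys k})))
          where
          eq : accepting inclusionᴬ (state inclusionᴬ (tracks (pair (A (i + position d)) (code (X k)))))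
            ≡ accepting inclusionᴬ (state inclusionᴬ (tracks (pair (A (i + position c)) (code (Zs k)))))
          eq = trans (cong (accepting inclusionᴬ) (state-tracks inclusionᴬ (pair (A (origin d j)) (code (Zs′ k))) v
                (pair Y (sub (code (Zs k)) u)) (pair (A (i + position d)) (code (X k))) λ { zero → ed ; (suc zero) → proj₂ (coded k) }))
            (trans (outside≡ k j _)
            (cong (accepting inclusionᴬ) (sym (state-tracks inclusionᴬ (pair (A (origin c j)) (code (Zs k))) u
                (pair Y (sub (code (Zs k)) u)) (pair (A (i + position c)) (code (Zs k)))
                λ { zero → ec ; (suc zero) → ≋-sym (graft-self (code (Zs k)) u) }))))
        ≈joined : ∀ k → X k ≈ˢ joinAll y Ys k
        ≈joined k = ≈-join (low k) (high k)
        relation-holds : R X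
        relation-holds = to (accepts-codes dR X) (trans eq (from (accepts-codes dR Zs) h))
          where
          eq : accepting relationᴬ (state relationᴬ (tracks (code ∘ X))) ≡ accepting relationᴬ (state relationᴬ (tracks (code ∘ Zs)))
          eq = trans (cong (accepting relationᴬ) (state-tracks relationᴬ (code ∘ Zs′) v (λ k → sub (code (Zs k)) u) (code ∘ X)
                (λ k → proj₂ (coded k))))
            (trans (proj₂ point-eq _)
            (cong (accepting relationᴬ) (sym (state-self relationᴬ (code ∘ Zs) u))))

  samePrefix-sym : ∀ {x y} → SamePrefix x y → SamePrefix y x
  samePrefix-sym ((e₁ , e₂ , e₃) , e₄) = (sym e₁ , sym e₂ , λ j k s → sym (e₃ j k s)) , λ t → sym (e₄ t)

  residual : ∀ {x y} → encode observePrefix x ≡ encode observePrefix y → ∀ Ys → R (joinAll x Ys) ⇔ R (joinAll y Ys)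
  residual {x} {y} e Ys = let s = sound observePrefix {x} {y} e in
    mk⇔ (transfer x y s Ys) (transfer y x (samePrefix-sym {x} {y} s) Ys)

  prefix : ∀ n Xs → ¬ ¬ (∃ λ x → position (cut x) ≡ n × sets x ≡ Xs)
  prefix n Xs = ¬¬-bind (contexts (proj₂ (cutNode n))) λ (o , cov) →
    let c = record { position = n ; place = proj₁ (cutNode n) ; isNode = proj₂ (cutNode n) ; origin = o ; covers = cov } in
    ¬¬-bind (¬¬-∀ (count observePoint) (λ t → ¬¬-excluded-middle)) λ dec →
      ¬¬-pure (record { cut = c ; sets = Xs ; decided = dec } , refl , refl)

markIf : Bool → ℕ → FinSet ℕ
markIf true  n = [ n ]
markIf false n = []

∈-markIf : ∀ b {n z} → (z ∈ markIf b n) ⇔ (b ≡ true × z ≡ n)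
∈-markIf true  = mk⇔ (λ { (here refl) → refl , refl }) (λ { (_ , refl) → here refl })
∈-markIf false = mk⇔ (λ ()) (λ { (() , _) })

prepend : Bool → FinSet ℕ → FinSet ℕ
prepend b Y = markIf b 0 ++ map suc Y

-- One letter moves between prefix and continuation. W is kept apart from X because the
-- representative of a state is lengthened by `extendBy`, whose result agrees with it only below n.
join-suc : ∀ {n W X} Y b → (∀ {z} → z < n → (z ∈ W) ⇔ (z ∈ X)) → (n ∈ W) ⇔ (b ≡ true)
  → join (suc n) W Y ≈ˢ join n X (prepend b Y)
join-suc {n} {W} {X} Y b low top = ≈-join {n} {X} {prepend b Y}
  (λ l → ⇔-trans (join-below {suc n} {W} {Y} (ℕₚ.m≤n⇒m≤1+n l)) (low l)) high
  where
  high : ∀ i → (i + n ∈ join (suc n) W Y) ⇔ (i ∈ prepend b Y)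
  high zero = ⇔-trans (join-below {suc n} {W} {Y} (ℕₚ.n<1+n n)) (⇔-trans top (mk⇔
    (λ e → ∈ₚ.∈-++⁺ˡ (from (∈-markIf b) (e , refl))) (λ h → case (∈ₚ.∈-++⁻ (markIf b 0) h))))
    where
    case : 0 ∈ markIf b 0 ⊎ 0 ∈ map suc Y → b ≡ true
    case (inj₁ h) = proj₁ (to (∈-markIf b) h)
    case (inj₂ h) with ∈ₚ.∈-map⁻ suc h
    ... | _ , _ , ()
  high (suc i) = ⇔-trans (mk⇔ (subst (_∈ join (suc n) W Y) (sym (ℕₚ.+-suc i n))) (subst (_∈ join (suc n) W Y) (ℕₚ.+-suc i n)))
    (⇔-trans (join-above {suc n} {W} {Y}) (mk⇔ (λ h → ∈ₚ.∈-++⁺ʳ (markIf b 0) (∈ₚ.∈-map⁺ suc h)) (λ h → case (∈ₚ.∈-++⁻ (markIf b 0) h))))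
    where
    case : suc i ∈ markIf b 0 ⊎ suc i ∈ map suc Y → i ∈ Y
    case (inj₁ h) = contradiction (proj₂ (to (∈-markIf b) h)) λ ()
    case (inj₂ h) with ∈ₚ.∈-map⁻ suc h
    ... | _ , k , refl = k

does-⇔ : {P : Set} (d : Dec P) → P ⇔ (does d ≡ true)
does-⇔ d = mk⇔ (dec-true d) (does-true d)

yes-from : {P : Set} (d : Dec P) → P → ∃ λ p → d ≡ yes p
yes-from (yes p) _ = p , refl
yes-from (no n)  p = ⊥-elim (n p)

module _ {r K : ℕ} {δ δ′ : Fin K → Fin (2 ^ r) → Fin K} {f f′ : Fin K → Bool} {q₀ : Fin K}
  (δ≡ : ∀ q a → δ q a ≡ δ′ q a) (f≡ : ∀ q → f q ≡ f′ q) where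

  run-cong : ∀ Xs n → DFA.run {r} δ f q₀ Xs n ≡ DFA.run {r} δ′ f′ q₀ Xs n
  run-cong Xs zero    = refl
  run-cong Xs (suc n) = trans (cong (λ q → δ q (letterAt Xs n)) (run-cong Xs n)) (δ≡ _ _)

  accepted-cong : ∀ {Xs} → DFA.Accepted {r} δ f q₀ Xs → DFA.Accepted {r} δ′ f′ q₀ Xs
  accepted-cong {Xs} (n , b , h) = n , b , trans (sym (f≡ _)) (trans (cong f (sym (run-cong Xs n))) h)

-- The automaton of residuals and its search

module Minimal (𝒫 : Presentation) {r : ℕ} {R : Env r → Set} (dR : DefinableIn 𝒫 R) where
  open Definability 𝒫
  open DefinableRelations 𝒫
  open Residuals 𝒫 dR
  open Cut
  open Prefix

  states : ℕ
  states = count observePrefix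

  Decides : (Fin states → Fin (2 ^ r) → Fin states) → (Fin states → Bool) → Fin states → Set
  Decides δ final q₀ = ∀ Xs → R Xs ⇔ DFA.Accepted {r} δ final q₀ Xs

  extendBy : ℕ → Env r → Fin (2 ^ r) → Env r
  extendBy n Xs a k = filter (_<? n) (Xs k) ++ markIf (member {r} a k) n

  number : Prefix → ℕ
  number x = position (cut x)

  opaque
    extendBy-below : ∀ n Xs a k {z} → z < n → (z ∈ extendBy n Xs a k) ⇔ (z ∈ Xs k)
    extendBy-below n Xs a k {z} l = mk⇔ (λ h → case (∈ₚ.∈-++⁻ (filter (_<? n) (Xs k)) h)) (λ h → ∈ₚ.∈-++⁺ˡ (∈ₚ.∈-filter⁺ (_<? n) h l))
      where
      case : z ∈ filter (_<? n) (Xs k) ⊎ z ∈ markIf (member {r} a k) n → z ∈ Xs k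
      case (inj₁ h) = proj₁ (∈ₚ.∈-filter⁻ (_<? n) {xs = Xs k} h)
      case (inj₂ h) = ⊥-elim (ℕₚ.<-irrefl (proj₂ (to (∈-markIf (member {r} a k)) h)) l)

    extendBy-top : ∀ n Xs a k → (n ∈ extendBy n Xs a k) ⇔ (member {r} a k ≡ true)
    extendBy-top n Xs a k = mk⇔ (λ h → case (∈ₚ.∈-++⁻ (filter (_<? n) (Xs k)) h))
      (λ e → ∈ₚ.∈-++⁺ʳ (filter (_<? n) (Xs k)) (from (∈-markIf (member {r} a k)) (e , refl)))
      where
      case : n ∈ filter (_<? n) (Xs k) ⊎ n ∈ markIf (member {r} a k) n → member {r} a k ≡ true
      case (inj₁ h) = ⊥-elim (ℕₚ.<-irrefl refl (proj₂ (∈ₚ.∈-filter⁻ (_<? n) {xs = Xs k} h)))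
      case (inj₂ h) = proj₁ (to (∈-markIf (member {r} a k)) h)

  module Build (rep? : ∀ d → Dec (∃ λ x → encode observePrefix x ≡ d)) where

    -- A transition is computed from the chosen representative of d instead of the prefix actually
    -- read; `residual` makes the choice harmless. Values without a representative are never reached
    -- by a run and may move anywhere.
    Next : Fin states → Fin (2 ^ r) → Fin states → Set
    Next d a d′ = ∀ x e → rep? d ≡ yes (x , e) →
      ∃ λ x′ → (number x′ ≡ suc (number x) × sets x′ ≡ extendBy (number x) (sets x) a) × encode observePrefix x′ ≡ d′

    next : ∀ d a → ¬ ¬ ∃ (Next d a)
    next d a with rep? d
    ... | no _        = ¬¬-pure (d , λ _ _ ())
    ... | yes (x , e) = ¬¬-bind (prefix (suc (number x)) (extendBy (number x) (sets x) a)) λ (x′ , h) →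
            ¬¬-pure (encode observePrefix x′ , λ { _ _ refl → x′ , h , refl })

    final : Fin states → Bool
    final d with rep? d
    ... | no _        = false
    ... | yes (x , _) = does (def? dR (joinAll x (λ _ → [])))

    module _ (δ : Fin states → Fin (2 ^ r) → Fin states) (δ-next : ∀ d a → Next d a (δ d a))
      (x₀ : Prefix) (x₀-number : number x₀ ≡ 0) where

      private
        q₀ = encode observePrefix x₀

      open DFA {r} δ final q₀ using (run; Accepted)

      -- The invariant of a run: what has been read and the representative of the state have the
      -- same residual. The length of the representative is unrelated to i.
      Represents : Env r → ℕ → Fin states → Set
      Represents Xs i d = ∃₂ λ x e → rep? d ≡ yes (x , e) × (∀ Ys → R (λ k → join i (Xs k) (Ys k)) ⇔ R (joinAll x Ys))

      represents : ∀ Xs i → Represents Xs i (run Xs i)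
      represents Xs zero with yes-from (rep? q₀) (x₀ , refl)
      ... | (x , e) , eq = x , e , eq , λ Ys → ⇔-trans
              (mk⇔ (def-cong dR (same Ys)) (def-cong dR (λ k → ≈ˢ-sym (same Ys k)))) (residual (sym e) Ys)
        where
        same : ∀ Ys k → join 0 (Xs k) (Ys k) ≈ˢ joinAll x₀ Ys k
        same Ys k rewrite x₀-number = ≈-join {0} {sets x₀ k} {Ys k} (λ ()) (λ i → join-above {0} {Xs k} {Ys k})
      represents Xs (suc i) with represents Xs i
      ... | x , e , eq , h with δ-next (run Xs i) (letterAt Xs i) x e eq
      ... | x′ , (n≡ , s≡) , e′ with yes-from (rep? (run Xs (suc i))) (x′ , e′)
      ... | (x″ , e″) , eq″ = x″ , e″ , eq″ , λ Ys →
              -- The last letter is handed to the continuation, the prefix is exchanged for its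
              -- representative, the letter is absorbed again, and `residual` passes to the
              -- representative of the new state.
              ⇔-trans (mk⇔ (def-cong dR (split Ys)) (def-cong dR (λ k → ≈ˢ-sym (split Ys k))))
              (⇔-trans (h (bump Ys))
              (⇔-trans (mk⇔ (def-cong dR (λ k → ≈ˢ-sym (glue Ys k))) (def-cong dR (glue Ys)))
              (residual (trans e′ (sym e″)) Ys)))
        where
        a : Fin (2 ^ r)
        a = letterAt Xs i
        bump : Env r → Env r
        bump Ys k = prepend (member {r} a k) (Ys k)
        split : ∀ Ys k → join (suc i) (Xs k) (Ys k) ≈ˢ join i (Xs k) (bump Ys k)
        split Ys k = join-suc (Ys k) (member {r} a k) (λ _ → mk⇔ id id)
          (subst (λ b → (i ∈ Xs k) ⇔ (b ≡ true)) (sym (member-subset (λ k → does (i ∈ℕ? Xs k)) k)) (does-⇔ (i ∈ℕ? Xs k)))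
        glue : ∀ Ys k → joinAll x′ Ys k ≈ˢ joinAll x (bump Ys) k
        glue Ys k rewrite n≡ | s≡ = join-suc (Ys k) (member {r} a k) (extendBy-below (number x) (sets x) a k)
          (extendBy-top (number x) (sets x) a k)

      final-correct : ∀ Xs n → (∀ k {i} → i ∈ Xs k → i < n) → R Xs ⇔ (final (run Xs n) ≡ true)
      final-correct Xs n X<n with represents Xs n
      ... | x , e , eq , h = ⇔-trans (mk⇔ (def-cong dR whole) (def-cong dR (λ k → ≈ˢ-sym (whole k))))
              (⇔-trans (h (λ _ → [])) (final-⇔ (run Xs n) eq))
        where
        whole : ∀ k → Xs k ≈ˢ join n (Xs k) []
        whole k = ≈-join {n} {Xs k} {[]} (λ _ → mk⇔ id id)
          (λ i → mk⇔ (λ i∈ → ⊥-elim (ℕₚ.<⇒≱ (X<n k i∈) (ℕₚ.m≤n+m n i))) λ ())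
        final-⇔ : ∀ d {e} → rep? d ≡ yes (x , e) → R (joinAll x (λ _ → [])) ⇔ (final d ≡ true)
        final-⇔ d eq with rep? d
        final-⇔ d refl | yes (x , _) = does-⇔ (def? dR (joinAll x (λ _ → [])))

      decides : Decides δ final q₀
      decides Xs = mk⇔
        (λ h → n , X<n , to (final-correct Xs n X<n) h)
        (λ (n , X<n , h) → from (final-correct Xs n X<n) h)
        where
        n : ℕ
        n = maxᶠ (bound ∘ Xs)
        X<n : ∀ k {i} → i ∈ Xs k → i < n
        X<n k h = ℕₚ.≤-trans (∈⇒<bound h) (≤maxᶠ (bound ∘ Xs) k)

  ¬¬-decides : ¬ ¬ (∃ λ δ → ∃ λ final → ∃ λ q₀ → Decides δ final q₀)
  ¬¬-decides = ¬¬-bind (¬¬-∀ states λ d → ¬¬-excluded-middle) λ rep? →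
    ¬¬-bind (¬¬-∀ states λ d → ¬¬-∀ (2 ^ r) λ a → Build.next rep? d a) λ δ →
    ¬¬-bind (prefix 0 (λ _ → [])) λ (x₀ , n≡ , _) →
    ¬¬-pure ((λ d a → proj₁ (δ d a)) , Build.final rep? , encode observePrefix x₀ ,
      Build.decides rep? (λ d a → proj₁ (δ d a)) (λ d a → proj₂ (δ d a)) x₀ n≡)

  -- Whether a given finite automaton decides R is a definable sentence, hence
  -- decidable; so a search through all automata of this size removes the ¬¬.
  decides? : ∀ δ final q₀ → Dec (Decides δ final q₀)
  decides? δ final q₀ = map⇔ (mk⇔
      (λ all Xs → let Xs′ , e , h = allSets-elim r all Xs in ⇔-trans (cong-⇔ dR Xs′ Xs e) (⇔-trans (mk⇔ (proj₁ h) (proj₂ h)) (⇔-sym (cong-⇔ accepted Xs′ Xs e))))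
      (λ h → allSets-intro r λ Xs → to (h Xs) , from (h Xs)))
    (def? {P = λ _ → AllSets r Correct} (def-AllSets r (λ _ → Correct) λ _ _ Qs vQs →
      def-× (def-→ (def-subst dR Qs vQs) (def-subst accepted Qs vQs)) (def-→ (def-subst accepted Qs vQs) (def-subst dR Qs vQs))) noVars)
    where
    accepted = def-Accepted {r} δ final q₀
    Correct : Env r → Set
    Correct Xs = (R Xs → DFA.Accepted {r} δ final q₀ Xs) × (DFA.Accepted {r} δ final q₀ Xs → R Xs)
    cong-⇔ : ∀ {P : Env r → Set} → Def P → ∀ Xs′ Xs → (∀ k → Xs′ k ≡ Xs k) → P Xs ⇔ P Xs′
    cong-⇔ d Xs′ Xs e = mk⇔ (def-cong d (λ k → ≈ˢ-reflexive (sym (e k)))) (def-cong d (λ k → ≈ˢ-reflexive (e k)))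

  -- Functions on finite sets are coded by numbers to make them searchable; `accepted-cong` repairs
  -- the difference between a function and its table.
  Table : Set
  Table = Fin (states ^ (states * 2 ^ r))

  lookupTable : Table → Fin states → Fin (2 ^ r) → Fin states
  lookupTable c d a = finToFun {states} {states * 2 ^ r} c (combine d a)

  Found : Set
  Found = ∃ λ (c : Table) → ∃ λ (g : Fin (2 ^ states)) → ∃ λ q₀ → Decides (lookupTable c) (member {states} g) q₀

  opaque
    found? : Dec Found
    found? = Finₚ.any? λ c → Finₚ.any? λ g → Finₚ.any? λ q₀ → decides? (lookupTable c) (member {states} g) q₀

    tabulated : (∃ λ δ → ∃ λ final → ∃ λ q₀ → Decides δ final q₀) → Found
    tabulated (δ , final , q₀ , h) = funToFin δ′ , subset final , q₀ , λ Xs → ⇔-trans (h Xs)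
      (mk⇔ (accepted-cong δ≡ f≡) (accepted-cong (λ d a → sym (δ≡ d a)) (λ d → sym (f≡ d))))
      where
      entry : Fin states × Fin (2 ^ r) → Fin states
      entry (d , a) = δ d a
      δ′ : Fin (states * 2 ^ r) → Fin states
      δ′ e = entry (remQuot {states} (2 ^ r) e)
      δ≡ : ∀ d a → δ d a ≡ lookupTable (funToFin δ′) d a
      δ≡ d a = sym (trans (Finₚ.finToFun-funToFin δ′ (combine d a)) (cong entry (Finₚ.remQuot-combine {states} d a)))
      f≡ : ∀ d → final d ≡ member (subset final) d
      f≡ d = sym (member-subset final d)

    found : Found
    found = decidable-stable found? (¬¬-map tabulated ¬¬-decides)

theorem5p7 : (r : ℕ) (R : (Fin r → FinSet ℕ) → Set)
    → (p : Presentation) → DefinableIn p R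
    → (q : Presentation) → DefinableIn q R
theorem5p7 r R p dR q =
  let c , g , q₀ , decides = Minimal.found p dR
  in Definability.def-⇔ q (λ Xs → ⇔-sym (decides Xs))
       (DefinableRelations.def-Accepted q {r} (Minimal.lookupTable p dR c) (member {Minimal.states p dR} g) q₀)
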